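{- There is a function $h(n)=\Theta(n)$ (positive) such that for every even natural number $n$ and every set $V$ of $n$ points in convex position in the plane, $\alpha(D_V(n))\ge \frac{n^2}{6}+h(n)$.
   Context: A set of $n$ points in the plane is in convex position if no three are collinear and they are the vertices of a convex polygon (all internal angles strictly less than $180^\circ$). For such a set $V$, the segment disjointness graph $D_V(n)$ has as vertices all closed straight-line segments with both endpoints in $V$, two segments being adjacent iff they are disjoint (no common point, including endpoints). An $l$-coloring of a graph $G$ is a surjective map $V(G)\to[l]$; it is proper if adjacent vertices get different colors and complete if for every two distinct colors $i,j$ there is an edge with endpoints colored $i$ and $j$. The achromatic number $\alpha(G)$ is the largest $l$ admitting a proper complete $l$-coloring. The paper writes the bound as $\frac{n^2}{6}+\Theta(n)\le \alpha(D_V(n))$. -}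

module Defs where

open import Level using (0ℓ)
open import Data.Nat as ℕ using (ℕ; suc)
open import Data.Nat.DivMod using (_%_; m%n<n)
open import Data.Fin as Fin using (Fin; toℕ; fromℕ<)
open import Data.Fin.Permutation using (Permutation′; _⟨$⟩ʳ_)
open import Data.Product using (Σ; ∃; ∃-syntax; _×_; _,_)
open import Data.Sum using (_⊎_)
open import Data.Empty using (⊥)
open import Relation.Nullary using (¬_)
open import Relation.Binary.PropositionalEquality using (_≡_; _≢_)
open import Function.Definitions using (Injective; Surjective)
open import Data.Rational as ℚ using (ℚ)
open import Data.Integer using (+_)

-- The real numbers, given axiomatically: a complete ordered field.
-- (Any two models are isomorphic, so quantifying over all models is
-- the same as speaking about ℝ.)

record RealField : Set₁ where
  infixl 6 _+_
  infixl 7 _*_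
  infix  4 _<_ _≤_
  field
    R      : Set
    0# 1#  : R
    _+_ _*_ : R → R → R
    -_     : R → R
    inv    : (x : R) → x ≢ 0# → R
    _<_    : R → R → Set
    +-assoc    : ∀ x y z → (x + y) + z ≡ x + (y + z)
    +-comm     : ∀ x y → x + y ≡ y + x
    +-identity : ∀ x → 0# + x ≡ x
    +-inverse  : ∀ x → x + (- x) ≡ 0#
    *-assoc    : ∀ x y z → (x * y) * z ≡ x * (y * z)
    *-comm     : ∀ x y → x * y ≡ y * x
    *-identity : ∀ x → 1# * x ≡ x
    distrib    : ∀ x y z → x * (y + z) ≡ (x * y) + (x * z)
    0≢1        : 0# ≢ 1#
    *-inverse  : ∀ x (nz : x ≢ 0#) → x * inv x nz ≡ 1#
    <-irrefl   : ∀ x → ¬ (x < x)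
    <-trans    : ∀ x y z → x < y → y < z → x < z
    <-tri      : ∀ x y → x < y ⊎ x ≡ y ⊎ y < x
    +-mono-<   : ∀ x y z → x < y → x + z < y + z
    *-pos      : ∀ x y → 0# < x → 0# < y → 0# < x * y
  _≤_ : R → R → Set
  x ≤ y = x < y ⊎ x ≡ y
  field
    complete : (P : R → Set) → ∃ P → (∃[ b ] (∀ x → P x → x ≤ b)) →
               ∃[ s ] ((∀ x → P x → x ≤ s) ×
                       (∀ b → (∀ x → P x → x ≤ b) → s ≤ b))
  _-_ : R → R → R
  x - y = x + (- y)

module Plane (ℝ : RealField) where
  open RealField ℝ

  Point : Set
  Point = R × R

  orient : Point → Point → Point → R
  orient (px , py) (qx , qy) (rx , ry) =
    ((qx - px) * (ry - py)) - ((qy - py) * (rx - px))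

  _∈Seg[_,_] : Point → Point → Point → Set
  (px , py) ∈Seg[ (ax , ay) , (bx , by) ] =
    ∃[ t ] (0# ≤ t × t ≤ 1# ×
            px ≡ ((1# - t) * ax) + (t * bx) ×
            py ≡ ((1# - t) * ay) + (t * by))

  SegDisjoint : Point → Point → Point → Point → Set
  SegDisjoint a b c d = ¬ (∃[ p ] (p ∈Seg[ a , b ] × p ∈Seg[ c , d ]))

  next : ∀ {n} → Fin n → Fin n
  next {suc m} i = fromℕ< (m%n<n (suc (toℕ i)) (suc m))

  -- A finite family of n points V is in convex position: the points are
  -- distinct, no three are collinear, and for some cyclic ordering σ they
  -- are the vertices of a (counterclockwise) convex polygon with all
  -- interior angles < 180°: every other vertex lies strictly to the left
  -- of every directed edge σ i → σ (i+1).
  ConvexPosition : ∀ {n} → (Fin n → Point) → Set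
  ConvexPosition {n} V =
    Injective _≡_ _≡_ V ×
    (∀ i j k → i ≢ j → j ≢ k → i ≢ k → orient (V i) (V j) (V k) ≢ 0#) ×
    Σ (Permutation′ n) (λ σ → ∀ i j → j ≢ i → j ≢ next i →
      0# < orient (V (σ ⟨$⟩ʳ i)) (V (σ ⟨$⟩ʳ next i)) (V (σ ⟨$⟩ʳ j)))

record Graph : Set₁ where
  field
    Vert : Set
    Adj  : Vert → Vert → Set

module _ (G : Graph) where
  open Graph G

  IsColoring : (l : ℕ) → (Vert → Fin l) → Set
  IsColoring l c = Surjective _≡_ _≡_ c

  IsProper : ∀ {l} → (Vert → Fin l) → Set
  IsProper c = ∀ u v → Adj u v → c u ≢ c v

  IsComplete : ∀ {l} → (Vert → Fin l) → Set
  IsComplete {l} c = ∀ (i j : Fin l) → i ≢ j →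
    ∃[ u ] ∃[ v ] (Adj u v × c u ≡ i × c v ≡ j)

  HasProperCompleteColoring : ℕ → Set
  HasProperCompleteColoring l =
    ∃[ c ] (IsColoring l c × IsProper c × IsComplete c)

  IsAchromaticNumber : ℕ → Set
  IsAchromaticNumber a =
    HasProperCompleteColoring a ×
    (∀ l → HasProperCompleteColoring l → l ℕ.≤ a)

-- a segment with endpoints V i, V j, recorded by indices i < j
record SegIx (n : ℕ) : Set where
  constructor seg
  field
    lo hi : Fin n
    lo<hi : lo Fin.< hi

D : (ℝ : RealField) → ∀ {n} → (Fin n → Plane.Point ℝ) → Graph
D ℝ {n} V = record
  { Vert = SegIx n
  ; Adj  = λ s t → SegDisjoint (V (SegIx.lo s)) (V (SegIx.hi s))
                                (V (SegIx.lo t)) (V (SegIx.hi t))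
  }
  where open Plane ℝ

ThetaN : (ℕ → ℚ) → Set
ThetaN h = ∃[ c₁ ] ∃[ c₂ ] ∃[ N ] (ℚ.0ℚ ℚ.< c₁ × ℚ.0ℚ ℚ.< c₂ ×
  (∀ n → N ℕ.≤ n →
     ℚ.0ℚ ℚ.< h n × c₁ ℚ.* ((+ n) ℚ./ 1) ℚ.≤ h n × h n ℚ.≤ c₂ ℚ.* ((+ n) ℚ./ 1)))

{-# OPTIONS --safe #-}

-- Alternate sides of the polygon are taken as one-element colour classes, and
-- triangles as three-element classes.  Two triangles with at most one common
-- vertex contain disjoint edges: one of them has an edge e avoiding the other
-- triangle, two of whose vertices lie on the same side of the line through e.
-- For the same reason a side and a triangle not containing it contain disjoint
-- edges.  So a family of triangles which pairwise share at most one vertex, and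
-- contain none of the chosen sides, gives pairwise joined classes; identifying
-- unjoined colours extends these to a proper complete colouring.
--
-- The families are variants of the Bose and Skolem constructions of Steiner
-- triple systems.  On three copies of Z_m one takes the triples
-- (x , i), (y , i), (x ∘ y , i + 1) for x ≠ y, where ∘ is a commutative
-- quasigroup; the chosen sides and the remaining triangles come from the
-- diagonal edges (x , i), (x ∘ x , i + 1) when n ≡ 0 or 4 (mod 6), while for
-- n ≡ 2 (mod 6) one deletes a point from a Steiner triple system.  With k = n / 2
-- sides and q triangles, 6 (k + q) + 8 ≥ n² + n.
module Submission where

open import Defs
open import Level using (0ℓ)
open import Algebra.Bundles using (CommutativeRing)
import Algebra.Properties.Ring as RingProperties
import Algebra.Solver.Ring.NaturalCoefficients.Default as SemiringSolver
open import Data.Nat as ℕ using (ℕ; zero; suc; z≤n; s≤s)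
open import Data.Nat.Properties as ℕₚ using ()
open import Data.Nat.DivMod using (_%_; _/_; m%n<n; m<n⇒m%n≡m; m≡m%n+[m/n]*n; [m+kn]%n≡m%n; _divMod_; result)
open import Data.Nat.Tactic.RingSolver using (solve-∀)
open import Data.Rational as ℚ using (ℚ)
open import Data.Rational.Properties as ℚₚ using ()
open import Data.Rational.Unnormalised as ℚᵘ using (mkℚᵘ; *≤*; *≡*)
open import Data.Rational.Unnormalised.Properties as ℚᵘₚ using ()
open import Data.Fin as Fin using (Fin; zero; suc; toℕ; fromℕ<; punchIn; punchOut; splitAt; join; combine; remQuot; opposite; _↑ˡ_; _↑ʳ_)
open import Data.Fin.Patterns using (0F; 1F; 2F)
open import Data.Fin.Permutation using (Permutation′; _⟨$⟩ʳ_; _⟨$⟩ˡ_; inverseˡ; inverseʳ)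
open import Data.Fin.Properties as Fₚ using (_≟_; any?; all?; <-cmp; <⇒≢; injective⇒≤; 0≢1+n; suc-injective; toℕ-injective; toℕ-fromℕ<; toℕ<n; toℕ-↑ˡ; toℕ-↑ʳ; toℕ-combine; combine-injective; combine-remQuot; splitAt-join; join-splitAt; splitAt-↑ˡ; splitAt-↑ʳ; punchOut-injective; punchIn-injective; punchInᵢ≢i; opposite-prop; opposite-involutive)
open import Data.Product using (Σ; ∃-syntax; _×_; _,_; proj₁; proj₂; uncurry; map₁; swap)
open import Data.Product.Properties using (≡-dec)
open import Data.Sum using (_⊎_; inj₁; inj₂)
open import Data.Sum.Properties using (inj₁-injective; inj₂-injective)
open import Data.Unit using (⊤; tt)
open import Data.Empty using (⊥; ⊥-elim)
open import Function using (_∘_)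
open import Relation.Nullary using (¬_; Dec; yes; no; contradiction)
open import Relation.Nullary.Decidable using (from-yes; map′; ¬?; _→-dec_; _⊎-dec_; _×-dec_)
open import Relation.Binary.Definitions using (DecidableEquality; tri<; tri≈; tri>)
open import Relation.Binary.PropositionalEquality using (_≡_; _≢_; refl; sym; trans; cong; cong₂; subst; subst₂; ≢-sym; isEquivalence; module ≡-Reasoning)

-- Segments and lines

module OrderedField (ℝ : RealField) where
  open RealField ℝ public

  commutativeRing : CommutativeRing 0ℓ 0ℓ
  commutativeRing = record
    { Carrier = R ; _≈_ = _≡_ ; _+_ = _+_ ; _*_ = _*_ ; -_ = λ x → - x ; 0# = 0# ; 1# = 1#
    ; isCommutativeRing = record
      { isRing = record
        { +-isAbelianGroup = record
          { isGroup = record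
            { isMonoid = record
              { isSemigroup = record
                { isMagma = record { isEquivalence = isEquivalence ; ∙-cong = cong₂ _+_ }
                ; assoc = +-assoc }
              ; identity = +-identity , λ x → trans (+-comm x 0#) (+-identity x) }
            ; inverse = (λ x → trans (+-comm (- x) x) (+-inverse x)) , +-inverse
            ; ⁻¹-cong = cong (λ x → - x) }
          ; comm = +-comm }
        ; *-cong = cong₂ _*_
        ; *-assoc = *-assoc
        ; *-identity = *-identity , λ x → trans (*-comm x 1#) (*-identity x)
        ; distrib = distrib , λ x y z →
            trans (*-comm (y + z) x) (trans (distrib x y z) (cong₂ _+_ (*-comm x y) (*-comm x z))) }
      ; *-comm = *-comm } }

  open CommutativeRing commutativeRing public
    using (ring; commutativeSemiring; zeroˡ; zeroʳ; +-identityʳ; -‿inverseˡ)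
  open RingProperties ring public
    using (-0#≈0#; -‿involutive; -1*x≈-x; -‿+-comm; -‿distribʳ-*)
  open SemiringSolver commutativeSemiring

  neg-pos : ∀ {x} → x < 0# → 0# < - x
  neg-pos {x} x<0 = subst₂ _<_ (+-inverse x) (+-identity (- x)) (+-mono-< x 0# (- x) x<0)

  convex-pos : ∀ {s t x y} → s + t ≡ 1# → 0# ≤ s → 0# ≤ t → 0# < x → 0# < y → (s * x) + (t * y) ≢ 0#
  convex-pos {s} {t} {x} {y} s+t≡1 (inj₂ refl) (inj₂ refl) _ _ _ =
    0≢1 (trans (sym (+-identity 0#)) s+t≡1)
  convex-pos {s} {t} {x} {y} s+t≡1 (inj₂ refl) (inj₁ 0<t) _ 0<y e =
    <-irrefl 0# (subst (0# <_) (trans (sym (trans (cong (_+ (t * y)) (zeroˡ x)) (+-identity (t * y)))) e)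
      (*-pos t y 0<t 0<y))
  convex-pos {s} {t} {x} {y} s+t≡1 (inj₁ 0<s) (inj₂ refl) 0<x _ e =
    <-irrefl 0# (subst (0# <_) (trans (sym (trans (cong ((s * x) +_) (zeroˡ y)) (+-identityʳ (s * x)))) e)
      (*-pos s x 0<s 0<x))
  convex-pos {s} {t} {x} {y} s+t≡1 (inj₁ 0<s) (inj₁ 0<t) 0<x 0<y e =
    <-irrefl 0# (<-trans 0# (t * y) 0# (*-pos t y 0<t 0<y)
      (subst₂ _<_ (+-identity (t * y)) e (+-mono-< 0# (s * x) (t * y) (*-pos s x 0<s 0<x))))

  convex-neg : ∀ {s t x y} → s + t ≡ 1# → 0# ≤ s → 0# ≤ t → x < 0# → y < 0# → (s * x) + (t * y) ≢ 0#
  convex-neg {s} {t} {x} {y} s+t≡1 0≤s 0≤t x<0 y<0 e =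
    convex-pos s+t≡1 0≤s 0≤t (neg-pos x<0) (neg-pos y<0) (begin
      (s * (- x)) + (t * (- y))   ≡⟨ cong₂ _+_ (-‿distribʳ-* s x) (-‿distribʳ-* t y) ⟨
      (- (s * x)) + (- (t * y))   ≡⟨ -‿+-comm (s * x) (t * y) ⟩
      - ((s * x) + (t * y))       ≡⟨ cong (λ x → - x) e ⟩
      - 0#                        ≡⟨ -0#≈0# ⟩
      0# ∎)
    where open ≡-Reasoning

  1-t+t≡1 : ∀ t → (1# - t) + t ≡ 1#
  1-t+t≡1 t = trans (+-assoc 1# (- t) t) (trans (cong (1# +_) (-‿inverseˡ t)) (+-identityʳ 1#))

  1-[1-t]≡t : ∀ t → 1# - (1# - t) ≡ t
  1-[1-t]≡t t = begin
    1# - (1# - t)                     ≡⟨ cong (_- (1# - t)) (1-t+t≡1 t) ⟨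
    ((1# - t) + t) - (1# - t)         ≡⟨ cong (_- (1# - t)) (+-comm (1# - t) t) ⟩
    (t + (1# - t)) - (1# - t)         ≡⟨ +-assoc t (1# - t) (- (1# - t)) ⟩
    t + ((1# - t) - (1# - t))         ≡⟨ cong (t +_) (+-inverse (1# - t)) ⟩
    t + 0#                            ≡⟨ +-identityʳ t ⟩
    t ∎
    where open ≡-Reasoning

  +-mono-≤ : ∀ {x y} z → x ≤ y → (x + z) ≤ (y + z)
  +-mono-≤ z (inj₁ x<y) = inj₁ (+-mono-< _ _ z x<y)
  +-mono-≤ z (inj₂ refl) = inj₂ refl

  0≤1-t : ∀ {t} → t ≤ 1# → 0# ≤ (1# - t)
  0≤1-t {t} t≤1 = subst (_≤ (1# - t)) (+-inverse t) (+-mono-≤ (- t) t≤1)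

  1-t≤1 : ∀ {t} → 0# ≤ t → (1# - t) ≤ 1#
  1-t≤1 {t} 0≤t = subst (_≤ 1#) (+-identity (1# - t))
    (subst ((0# + (1# - t)) ≤_) (trans (+-comm t (1# - t)) (1-t+t≡1 t)) (+-mono-≤ (1# - t) 0≤t))

  -- 1 < 0 would make 1 = (−1)(−1) positive.
  0<1 : 0# < 1#
  0<1 with <-tri 0# 1#
  ... | inj₁ p = p
  ... | inj₂ (inj₁ e) = contradiction e 0≢1
  ... | inj₂ (inj₂ p) = subst (0# <_) (trans (-1*x≈-x (- 1#)) (-‿involutive 1#))
                          (*-pos (- 1#) (- 1#) (neg-pos p) (neg-pos p))

  line-affine : ∀ A B s t ax bx ay by px py → s + t ≡ 1# →
    (A * (((s * ay) + (t * by)) - py)) - (B * (((s * ax) + (t * bx)) - px)) ≡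
    (s * ((A * (ay - py)) - (B * (ax - px)))) + (t * ((A * (by - py)) - (B * (bx - px))))
  line-affine A B s t ax bx ay by px py s+t≡1 = begin
    (A * (((s * ay) + (t * by)) - py)) - (B * (((s * ax) + (t * bx)) - px))
      -- Weighting the constants `- py` and `- px` by `s + t` makes both sides linear in `s` and
      -- `t`; what remains is a semiring identity with `- 1#`, `- px` and `- py` as variables.
      ≡⟨ cong₂ (λ u v → (A * (((s * ay) + (t * by)) + u)) - (B * (((s * ax) + (t * bx)) + v)))
           (weigh (- py)) (weigh (- px)) ⟩
    (A * (((s * ay) + (t * by)) + ((s + t) * (- py)))) - (B * (((s * ax) + (t * bx)) + ((s + t) * (- px))))
      ≡⟨ cong ((A * (((s * ay) + (t * by)) + ((s + t) * (- py)))) +_) (sym (-1*x≈-x _)) ⟩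
    (A * (((s * ay) + (t * by)) + ((s + t) * (- py)))) + ((- 1#) * (B * (((s * ax) + (t * bx)) + ((s + t) * (- px)))))
      ≡⟨ solve 11 (λ A B s t ax bx ay by px py n →
           (A :* (((s :* ay) :+ (t :* by)) :+ ((s :+ t) :* py))) :+ (n :* (B :* (((s :* ax) :+ (t :* bx)) :+ ((s :+ t) :* px))))
           := (s :* ((A :* (ay :+ py)) :+ (n :* (B :* (ax :+ px))))) :+ (t :* ((A :* (by :+ py)) :+ (n :* (B :* (bx :+ px))))))
         refl A B s t ax bx ay by (- px) (- py) (- 1#) ⟩
    (s * ((A * (ay - py)) + ((- 1#) * (B * (ax - px))))) + (t * ((A * (by - py)) + ((- 1#) * (B * (bx - px)))))
      ≡⟨ cong₂ (λ u v → (s * ((A * (ay - py)) + u)) + (t * ((A * (by - py)) + v))) (-1*x≈-x _) (-1*x≈-x _) ⟩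
    (s * ((A * (ay - py)) - (B * (ax - px)))) + (t * ((A * (by - py)) - (B * (bx - px)))) ∎
    where
    open ≡-Reasoning
    weigh : ∀ x → x ≡ (s + t) * x
    weigh x = trans (sym (*-identity x)) (cong (_* x) (sym s+t≡1))

module Segments (ℝ : RealField) where
  open OrderedField ℝ
  open Plane ℝ

  -- With `P` and `Q` fixed, the orientation determinant is affine in its third argument.
  orient-combination : ∀ P Q {a b p} (p∈ab : p ∈Seg[ a , b ]) → let t = proj₁ p∈ab in
    orient P Q p ≡ ((1# - t) * orient P Q a) + (t * orient P Q b)
  orient-combination (px , py) (qx , qy) {ax , ay} {bx , by} (t , _ , _ , refl , refl) =
    line-affine (qx - px) (qy - py) (1# - t) t ax bx ay by px py (1-t+t≡1 t)

  orient-left : ∀ P Q → orient P Q P ≡ 0#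
  orient-left (px , py) (qx , qy) = trans
    (cong₂ _-_ (trans (cong ((qx - px) *_) (+-inverse py)) (zeroʳ _))
               (trans (cong ((qy - py) *_) (+-inverse px)) (zeroʳ _)))
    (+-inverse 0#)

  orient-right : ∀ P Q → orient P Q Q ≡ 0#
  orient-right (px , py) (qx , qy) = trans
    (cong (λ u → ((qx - px) * (qy - py)) - u) (*-comm (qy - py) (qx - px)))
    (+-inverse _)

  orient-on : ∀ P Q {p} → p ∈Seg[ P , Q ] → orient P Q p ≡ 0#
  orient-on P Q p∈@(t , _) = trans (orient-combination P Q p∈)
    (trans (cong₂ (λ u v → ((1# - t) * u) + (t * v)) (orient-left P Q) (orient-right P Q))
      (trans (cong₂ _+_ (zeroʳ _) (zeroʳ _)) (+-identity 0#)))

  -- The orientation at a common point would vanish, the point being on `PQ`, and yet be a convex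
  -- combination of two positive values.
  sameSidePos⇒disjoint : ∀ {P Q a b} → 0# < orient P Q a → 0# < orient P Q b → SegDisjoint P Q a b
  sameSidePos⇒disjoint {P} {Q} oa ob (p , p∈PQ , p∈ab@(t , 0≤t , t≤1 , _)) =
    convex-pos (1-t+t≡1 t) (0≤1-t t≤1) 0≤t oa ob
      (trans (sym (orient-combination P Q p∈ab)) (orient-on P Q p∈PQ))

  sameSideNeg⇒disjoint : ∀ {P Q a b} → orient P Q a < 0# → orient P Q b < 0# → SegDisjoint P Q a b
  sameSideNeg⇒disjoint {P} {Q} oa ob (p , p∈PQ , p∈ab@(t , 0≤t , t≤1 , _)) =
    convex-neg (1-t+t≡1 t) (0≤1-t t≤1) 0≤t oa ob
      (trans (sym (orient-combination P Q p∈ab)) (orient-on P Q p∈PQ))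

  start∈Seg : ∀ a b → a ∈Seg[ a , b ]
  start∈Seg (ax , ay) (bx , by) = 0# , inj₂ refl , inj₁ 0<1 , start ax bx , start ay by
    where
    start : ∀ x y → x ≡ ((1# - 0#) * x) + (0# * y)
    start x y = sym (trans (cong₂ (λ u v → (u * x) + v) (trans (cong (1# +_) -0#≈0#) (+-identityʳ 1#)) (zeroˡ y))
                      (trans (+-identityʳ _) (*-identity x)))

  swap∈Seg : ∀ {a b p} → p ∈Seg[ a , b ] → p ∈Seg[ b , a ]
  swap∈Seg {ax , ay} {bx , by} (t , 0≤t , t≤1 , refl , refl) =
    (1# - t) , 0≤1-t t≤1 , 1-t≤1 0≤t , flip ax bx , flip ay by
    where
    flip : ∀ x y → ((1# - t) * x) + (t * y) ≡ ((1# - (1# - t)) * y) + ((1# - t) * x)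
    flip x y = trans (+-comm _ _) (cong (λ u → (u * y) + ((1# - t) * x)) (sym (1-[1-t]≡t t)))

  swapˡ-disjoint : ∀ {a b c d} → SegDisjoint a b c d → SegDisjoint b a c d
  swapˡ-disjoint dis (p , p∈ba , p∈cd) = dis (p , swap∈Seg p∈ba , p∈cd)

  swap-disjoint : ∀ {a b c d} → SegDisjoint a b c d → SegDisjoint c d a b
  swap-disjoint dis (p , p∈cd , p∈ab) = dis (p , p∈ab , p∈cd)

  -- Two of the three points lie on the same side of the line.
  edgeMissingLine : ∀ P Q (T : Fin 3 → Point) → (∀ i → orient P Q (T i) ≢ 0#) →
    ∃[ i ] ∃[ j ] (i ≢ j × SegDisjoint P Q (T i) (T j))
  edgeMissingLine P Q T off with side 0F | side 1F | side 2F
    where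
    side : ∀ i → orient P Q (T i) < 0# ⊎ 0# < orient P Q (T i)
    side i with <-tri (orient P Q (T i)) 0#
    ... | inj₁ p = inj₁ p
    ... | inj₂ (inj₁ e) = contradiction e (off i)
    ... | inj₂ (inj₂ p) = inj₂ p
  ... | inj₁ a | inj₁ b | _      = 0F , 1F , (λ ()) , sameSideNeg⇒disjoint a b
  ... | inj₂ a | inj₂ b | _      = 0F , 1F , (λ ()) , sameSidePos⇒disjoint a b
  ... | inj₁ a | inj₂ b | inj₁ c = 0F , 2F , (λ ()) , sameSideNeg⇒disjoint a c
  ... | inj₁ a | inj₂ b | inj₂ c = 1F , 2F , (λ ()) , sameSidePos⇒disjoint b c
  ... | inj₂ a | inj₁ b | inj₁ c = 1F , 2F , (λ ()) , sameSideNeg⇒disjoint b c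
  ... | inj₂ a | inj₁ b | inj₂ c = 0F , 2F , (λ ()) , sameSidePos⇒disjoint a c

-- Complete colourings

join-injective : ∀ m n x y → join m n x ≡ join m n y → x ≡ y
join-injective m n x y eq =
  trans (sym (splitAt-join m n x)) (trans (cong (splitAt m) eq) (splitAt-join m n y))

splitAt-injective : ∀ m {n} {i j : Fin (m ℕ.+ n)} → splitAt m i ≡ splitAt m j → i ≡ j
splitAt-injective m {n} {i} {j} eq =
  trans (sym (join-splitAt m n i)) (trans (cong (join m n) eq) (join-splitAt m n j))

remQuot-injective : ∀ m n {i j : Fin (m ℕ.* n)} → remQuot {m} n i ≡ remQuot {m} n j → i ≡ j
remQuot-injective m n {i} {j} eq =
  trans (sym (combine-remQuot {m} n i)) (trans (cong (uncurry (combine {m} {n})) eq) (combine-remQuot {m} n j))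

-- Double-negation shift over a finite index set; it lets colours be merged without a procedure
-- deciding whether two colours are joined.
¬¬-∀-Fin : ∀ {n} {P : Fin n → Set} → (∀ i → ¬ ¬ P i) → ¬ ¬ (∀ i → P i)
¬¬-∀-Fin {zero}  p k = k λ ()
¬¬-∀-Fin {suc n} p k = p zero λ p₀ → ¬¬-∀-Fin (p ∘ suc) λ ps →
  k λ { zero → p₀ ; (suc i) → ps i }

-- Colour `j` is sent to the image of `i` and then dropped from the range.
identify : ∀ {n} (i j : Fin (suc n)) → i ≢ j → Fin (suc n) → Fin n
identify i j i≢j x with j ≟ x
... | yes _   = punchOut (≢-sym i≢j)
... | no  j≢x = punchOut j≢x

identify-fibres : ∀ {n} {i j : Fin (suc n)} {i≢j : i ≢ j} {x y} →
  identify i j i≢j x ≡ identify i j i≢j y → x ≡ y ⊎ (x ≡ i × y ≡ j) ⊎ (x ≡ j × y ≡ i)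
identify-fibres {i = i} {j} {i≢j} {x} {y} eq with j ≟ x | j ≟ y
... | yes refl | yes refl = inj₁ refl
... | yes refl | no j≢y   = inj₂ (inj₂ (refl , sym (punchOut-injective (≢-sym i≢j) j≢y eq)))
... | no j≢x   | yes refl = inj₂ (inj₁ (punchOut-injective j≢x (≢-sym i≢j) eq , refl))
... | no j≢x   | no j≢y   = inj₁ (punchOut-injective j≢x j≢y eq)

module _ (G : Graph) (adj-sym : ∀ {u v} → Graph.Adj G u v → Graph.Adj G v u) where
  open Graph G

  -- Identifying unjoined colours never merges two of the colours r i.
  Core : ∀ {L} → ℕ → (Vert → Fin L) → Set
  Core {L} l c = Σ (Fin l → Fin L) λ r → ∀ i j → i ≢ j → ∃[ u ] ∃[ v ] (Adj u v × c u ≡ r i × c v ≡ r j)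

  -- Properness makes the representatives `r i` distinct, so merging can never go below `l` colours.
  core≤ : ∀ {L l} {c : Vert → Fin L} → IsProper G c → Core l c → l ℕ.≤ L
  core≤ {c = c} proper (r , edge) = injective⇒≤ {f = r} inj
    where
    inj : ∀ {i j} → r i ≡ r j → i ≡ j
    inj {i} {j} ri≡rj with i ≟ j
    ... | yes i≡j = i≡j
    ... | no i≢j with u , v , uv , cu , cv ← edge i j i≢j =
      contradiction (trans cu (trans ri≡rj (sym cv))) (proper u v uv)

  complete⇒surjective : ∀ {L} {c : Vert → Fin L} → 2 ℕ.≤ L → IsComplete G c → IsColoring G L c
  complete⇒surjective {suc (suc L)} (ℕ.s≤s (ℕ.s≤s _)) complete i with another i
    where
    another : ∀ i → ∃[ j ] (i ≢ j)
    another zero    = suc zero , λ ()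
    another (suc i) = zero , λ ()
  ... | j , i≢j with u , v , uv , cu , cv ← complete i j i≢j = u , λ { refl → cu }

  -- Identify two colours that are not joined by an edge, until every two colours are joined.
  completeColoring : ∀ {L l} {c : Vert → Fin L} → 2 ℕ.≤ l → IsProper G c → Core l c →
    ¬ ¬ (∃[ l′ ] (l ℕ.≤ l′ × HasProperCompleteColoring G l′))
  completeColoring {zero} 2≤l proper core _ with () ← ℕₚ.≤-trans 2≤l (core≤ proper core)
  completeColoring {suc L} {l} {c} 2≤l proper core@(r , edge) none =
    ¬¬-∀-Fin (λ i → ¬¬-∀-Fin λ j → joined i j) λ complete →
      none (suc L , core≤ proper core , c ,
            complete⇒surjective (ℕₚ.≤-trans 2≤l (core≤ proper core)) complete , proper , complete)
    where
    joined : ∀ i j → ¬ ¬ (i ≢ j → ∃[ u ] ∃[ v ] (Adj u v × c u ≡ i × c v ≡ j))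
    joined i j ¬joined with i ≟ j
    ... | yes i≡j = ¬joined λ i≢j → contradiction i≡j i≢j
    -- Since a double negation is being proved, `i` and `j` may be assumed unjoined. Merging them
    -- keeps the colouring proper, and the recursion with one colour fewer refutes `none`.
    ... | no i≢j = completeColoring {c = identify i j i≢j ∘ c} 2≤l proper′
        (identify i j i≢j ∘ r , λ a b a≢b → let u , v , uv , cu , cv = edge a b a≢b in
          u , v , uv , cong (identify i j i≢j) cu , cong (identify i j i≢j) cv)
        none
      where
      proper′ : IsProper G (identify i j i≢j ∘ c)
      proper′ u v uv eq with identify-fibres eq
      ... | inj₁ cu≡cv             = proper u v uv cu≡cv
      ... | inj₂ (inj₁ (cu , cv))  = ¬joined λ _ → u , v , uv , cu , cv
      ... | inj₂ (inj₂ (cu , cv))  = ¬joined λ _ → v , u , adj-sym uv , cv , cu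

-- Blocks of vertices and the colourings they induce

infix 4 _∈ᵇ_ _∉ᵇ_

_∈ᵇ_ _∉ᵇ_ : {P : Set} → P → (Fin 3 → P) → Set
p ∈ᵇ B = ∃[ i ] (B i ≡ p)
p ∉ᵇ B = ¬ (p ∈ᵇ B)

-- The edge of T opposite its vertex r avoids B. A two-point block is written with its second point repeated.
record EdgeAvoids {P : Set} (B T : Fin 3 → P) : Set where
  constructor avoiding
  field
    r      : Fin 3
    edge   : T (punchIn r 0F) ≢ T (punchIn r 1F)
    avoids : ∀ i → i ≢ r → T i ∉ᵇ B

-- For two genuine triangles this amounts to having at most one common point. The alternative is
-- needed for a side that touches a triangle: only the triangle then has an edge avoiding the other
-- block.
Separated : {P : Set} → (B T : Fin 3 → P) → Set
Separated B T = EdgeAvoids B T ⊎ EdgeAvoids T B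

edgeAvoids⇒meetOnce : ∀ {P : Set} {B T : Fin 3 → P} {p q} → EdgeAvoids B T →
  p ∈ᵇ B → q ∈ᵇ B → p ∈ᵇ T → q ∈ᵇ T → p ≡ q
edgeAvoids⇒meetOnce (avoiding r _ avoids) pB qB (i , refl) (j , refl) with i ≟ r | j ≟ r
... | no i≢r   | _        = contradiction pB (avoids i i≢r)
... | yes _    | no j≢r   = contradiction qB (avoids j j≢r)
... | yes refl | yes refl = refl

separated⇒meetOnce : ∀ {P : Set} {B T : Fin 3 → P} {p q} → Separated B T →
  p ∈ᵇ B → q ∈ᵇ B → p ∈ᵇ T → q ∈ᵇ T → p ≡ q
separated⇒meetOnce (inj₁ a) pB qB pT qT = edgeAvoids⇒meetOnce a pB qB pT qT
separated⇒meetOnce (inj₂ a) pB qB pT qT = edgeAvoids⇒meetOnce a pT qT pB qB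

-- Pigeonhole on three indices, checked by evaluating all cases; it is why the segments inside one
-- block may share a colour.
triangleEdgesMeet : ∀ (i j k l : Fin 3) → i ≢ j → k ≢ l → (i ≡ k ⊎ i ≡ l) ⊎ (j ≡ k ⊎ j ≡ l)
triangleEdgesMeet = from-yes (all? {n = 3} λ i → all? {n = 3} λ j → all? {n = 3} λ k → all? {n = 3} λ l →
  ¬? (i ≟ j) →-dec ¬? (k ≟ l) →-dec (((i ≟ k) ⊎-dec (i ≟ l)) ⊎-dec ((j ≟ k) ⊎-dec (j ≟ l))))

module _ (ℝ : RealField) {n : ℕ} (V : Fin n → Plane.Point ℝ) where
  open Segments ℝ
  open Plane ℝ
  open SegIx

  endpoint : SegIx n → Fin 2 → Fin n
  endpoint s 0F = lo s
  endpoint s 1F = hi s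

  _⊂_ : SegIx n → (Fin 3 → Fin n) → Set
  s ⊂ B = lo s ∈ᵇ B × hi s ∈ᵇ B

  _⊂?_ : ∀ s B → Dec (s ⊂ B)
  s ⊂? B = any? (λ i → B i ≟ lo s) ×-dec any? (λ i → B i ≟ hi s)

  Adj : SegIx n → SegIx n → Set
  Adj = Graph.Adj (D ℝ V)

  end∈Seg : ∀ s b → V (endpoint s b) ∈Seg[ V (lo s) , V (hi s) ]
  end∈Seg s 0F = start∈Seg _ _
  end∈Seg s 1F = swap∈Seg (start∈Seg _ _)

  commonEnd⇒¬Adj : ∀ s t a b → endpoint s a ≡ endpoint t b → ¬ Adj s t
  commonEnd⇒¬Adj s t a b eq adj =
    adj (V (endpoint s a) , end∈Seg s a , subst (λ p → V p ∈Seg[ _ , _ ]) (sym eq) (end∈Seg t b))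

  sameBlock⇒¬Adj : ∀ B s t → s ⊂ B → t ⊂ B → ¬ Adj s t
  sameBlock⇒¬Adj B s t ((i , Bi) , (j , Bj)) ((k , Bk) , (l , Bl))
    with triangleEdgesMeet i j k l
           (λ { refl → <⇒≢ (lo<hi s) (trans (sym Bi) Bj) })
           (λ { refl → <⇒≢ (lo<hi t) (trans (sym Bk) Bl) })
  ... | inj₁ (inj₁ refl) = commonEnd⇒¬Adj s t 0F 0F (trans (sym Bi) Bk)
  ... | inj₁ (inj₂ refl) = commonEnd⇒¬Adj s t 0F 1F (trans (sym Bi) Bl)
  ... | inj₂ (inj₁ refl) = commonEnd⇒¬Adj s t 1F 0F (trans (sym Bj) Bk)
  ... | inj₂ (inj₂ refl) = commonEnd⇒¬Adj s t 1F 1F (trans (sym Bj) Bl)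

  segment : ∀ {u v : Fin n} → u ≢ v → SegIx n
  segment {u} {v} u≢v with <-cmp u v
  ... | tri< u<v _ _ = seg u v u<v
  ... | tri≈ _ u≡v _ = contradiction u≡v u≢v
  ... | tri> _ _ v<u = seg v u v<u

  segment⊂ : ∀ {u v} (u≢v : u ≢ v) {B} → u ∈ᵇ B → v ∈ᵇ B → segment u≢v ⊂ B
  segment⊂ {u} {v} u≢v uB vB with <-cmp u v
  ... | tri< _ _ _   = uB , vB
  ... | tri≈ _ u≡v _ = contradiction u≡v u≢v
  ... | tri> _ _ _   = vB , uB

  segment-adjˡ : ∀ {u v} (u≢v : u ≢ v) {a b} → SegDisjoint (V u) (V v) a b →
    SegDisjoint (V (lo (segment u≢v))) (V (hi (segment u≢v))) a b
  segment-adjˡ {u} {v} u≢v dis with <-cmp u v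
  ... | tri< _ _ _   = dis
  ... | tri≈ _ u≡v _ = contradiction u≡v u≢v
  ... | tri> _ _ _   = swapˡ-disjoint dis

  segment-adj : ∀ {u v a b} (u≢v : u ≢ v) (a≢b : a ≢ b) → SegDisjoint (V u) (V v) (V a) (V b) →
    Adj (segment u≢v) (segment a≢b)
  segment-adj u≢v a≢b dis = segment-adjˡ u≢v (swap-disjoint (segment-adjˡ a≢b (swap-disjoint dis)))

  -- The geometric input of the colouring argument; it is proved in different ways for sides and for
  -- triangles.
  Dodges : (Fin 3 → Fin n) → Set
  Dodges B = ∀ {a b} → a ≢ b → a ∉ᵇ B → b ∉ᵇ B →
    ∃[ i ] ∃[ j ] (B i ≢ B j × SegDisjoint (V (B i)) (V (B j)) (V a) (V b))

  module _ {l : ℕ} (block : Fin l → Fin 3 → Fin n)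
           (dodges : ∀ i → Dodges (block i))
           (separated : ∀ {i j} → i ≢ j → Separated (block i) (block j)) where

    blockOf? : ∀ s → Dec (∃[ i ] (s ⊂ block i))
    blockOf? s = any? λ i → s ⊂? block i

    -- A segment lying in no block receives a private colour. The resulting colouring is only
    -- proper; completeness comes later from merging colours.
    label : SegIx n → Fin l ⊎ Fin (n ℕ.* n)
    label s with blockOf? s
    ... | yes (i , _) = inj₁ i
    ... | no  _       = inj₂ (combine (lo s) (hi s))

    coloring : SegIx n → Fin (l ℕ.+ n ℕ.* n)
    coloring s = join l (n ℕ.* n) (label s)

    label-proper : ∀ s t → Adj s t → label s ≢ label t
    label-proper s t adj eq with blockOf? s | blockOf? t
    ... | yes (i , s⊂) | yes (j , t⊂) with refl ← inj₁-injective eq = sameBlock⇒¬Adj (block i) s t s⊂ t⊂ adj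
    ... | no _ | no _ = commonEnd⇒¬Adj s t 0F 0F
                          (proj₁ (combine-injective (lo s) (hi s) (lo t) (hi t) (inj₂-injective eq))) adj

    -- Two blocks with at most one common point share no segment, so the search can only return `i`.
    label-block : ∀ {i} s → s ⊂ block i → label s ≡ inj₁ i
    label-block {i} s s⊂@(loB , hiB) with blockOf? s
    ... | no none = contradiction (i , s⊂) none
    ... | yes (j , loC , hiC) with i ≟ j
    ...   | yes refl = refl
    ...   | no i≢j   = contradiction (separated⇒meetOnce (separated i≢j) loB hiB loC hiC) (<⇒≢ (lo<hi s))

    Edge : Fin l → Fin l → Set
    Edge i j = ∃[ u ] ∃[ v ] (Adj u v × u ⊂ block i × v ⊂ block j)

    avoided⇒edge : ∀ i j → EdgeAvoids (block i) (block j) → Edge i j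
    avoided⇒edge i j (avoiding r edge avoids)
      with p , q , p≢q , dis ← dodges i edge (avoids _ (punchInᵢ≢i r 0F)) (avoids _ (punchInᵢ≢i r 1F)) =
      segment p≢q , segment edge , segment-adj p≢q edge dis ,
      segment⊂ p≢q (p , refl) (q , refl) , segment⊂ edge (_ , refl) (_ , refl)

    core : ∀ i j → i ≢ j → Edge i j
    core i j i≢j with separated i≢j
    ... | inj₁ a = avoided⇒edge i j a
    ... | inj₂ a with u , v , uv , u⊂ , v⊂ ← avoided⇒edge j i a = v , u , swap-disjoint uv , v⊂ , u⊂

    blocks≤achromatic : ∀ {a} → 2 ℕ.≤ l → IsAchromaticNumber (D ℝ V) a → l ℕ.≤ a
    blocks≤achromatic {a} 2≤l (_ , greatest) with l ℕ.≤? a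
    ... | yes l≤a = l≤a
    -- The complete colouring exists only up to double negation, which suffices because `≤` on
    -- naturals is decidable and the goal has become `⊥`.
    ... | no l≰a = ⊥-elim (completeColoring (D ℝ V) swap-disjoint {c = coloring} 2≤l
      (λ s t adj eq → label-proper s t adj (join-injective l (n ℕ.* n) (label s) (label t) eq))
      ((λ i → join l (n ℕ.* n) (inj₁ i)) , λ i j i≢j →
        let u , v , uv , u⊂ , v⊂ = core i j i≢j in
        u , v , uv , cong (join l _) (label-block u u⊂) , cong (join l _) (label-block v v⊂))
      λ { (l′ , l≤l′ , has) → l≰a (ℕₚ.≤-trans l≤l′ (greatest l′ has)) })

-- From triangle packings to colourings

-- A point (κ , b) of Fin k × Fin 2 is vertex 2κ + b of the polygon, so the pairs {κ} × Fin 2 are every other side.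
record Packing (k q : ℕ) : Set where
  field
    triangle   : Fin q → Fin 3 → Fin k × Fin 2
    noSide     : ∀ a {i j} → i ≢ j → proj₁ (triangle a i) ≢ proj₁ (triangle a j)
    separated  : ∀ {a b} → a ≢ b → Separated (triangle a) (triangle b)

EdgeAvoids-map : ∀ {P P′ : Set} {B T : Fin 3 → P} (f : P → P′) →
  (∀ i j → f (T i) ≡ f (T j) → T i ≡ T j) → (∀ i j → f (B i) ≡ f (T j) → B i ≡ T j) →
  EdgeAvoids B T → EdgeAvoids (f ∘ B) (f ∘ T)
EdgeAvoids-map f injT injB (avoiding r edge avoids) =
  avoiding r (edge ∘ injT _ _) λ i i≢r (j , eq) → avoids i i≢r (j , injB j i eq)

-- Injectivity is asked on valid points only, because the placements below may send a deleted point
-- to an occupied position.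
Separated-map : ∀ {P P′ : Set} {B T : Fin 3 → P} (f : P → P′) (Valid : P → Set) →
  (∀ {p q} → Valid p → Valid q → f p ≡ f q → p ≡ q) →
  (∀ i → Valid (B i)) → (∀ i → Valid (T i)) →
  Separated B T → Separated (f ∘ B) (f ∘ T)
Separated-map f Valid inj vB vT (inj₁ a) =
  inj₁ (EdgeAvoids-map f (λ i j → inj (vT i) (vT j)) (λ i j → inj (vB i) (vT j)) a)
Separated-map f Valid inj vB vT (inj₂ a) =
  inj₂ (EdgeAvoids-map f (λ i j → inj (vB i) (vB j)) (λ i j → inj (vT i) (vB j)) a)

module _ {k : ℕ} where

  sideBlock : Fin k → Fin 3 → Fin k × Fin 2
  sideBlock κ 0F = κ , 0F
  sideBlock κ 1F = κ , 1F
  sideBlock κ 2F = κ , 1F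

  ∈side : ∀ {κ p} → p ∈ᵇ sideBlock κ → proj₁ p ≡ κ
  ∈side (0F , refl) = refl
  ∈side (1F , refl) = refl
  ∈side (2F , refl) = refl

  side-side : ∀ {κ κ′} → κ ≢ κ′ → EdgeAvoids (sideBlock κ) (sideBlock κ′)
  side-side κ≢κ′ = avoiding 2F (λ ()) λ i _ i∈ → κ≢κ′ (trans (sym (∈side i∈)) (∈side (i , refl)))

  -- A triangle has at most one vertex on the side `κ`. If there is one, the opposite edge avoids
  -- the side; otherwise any edge does.
  side-triangle : ∀ κ {T : Fin 3 → Fin k × Fin 2} → (∀ {i j} → i ≢ j → proj₁ (T i) ≢ proj₁ (T j)) →
    EdgeAvoids (sideBlock κ) T
  side-triangle κ {T} noSide with any? (λ i → proj₁ (T i) ≟ κ)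
  ... | yes (r , Tr) = avoiding r (noSide (0≢1+n ∘ punchIn-injective r 0F 1F) ∘ cong proj₁)
                         λ i i≢r i∈ → noSide i≢r (trans (∈side i∈) (sym Tr))
  ... | no none      = avoiding 0F (noSide (λ ()) ∘ cong proj₁) λ i _ i∈ → none (i , ∈side i∈)

-- The index 2κ + 1 is still below 2k, so the successor does not wrap around.
next-combine : ∀ {k} (κ : Fin k) (ℝ : RealField) → Plane.next ℝ (combine κ 0F) ≡ combine {k} {2} κ 1F
next-combine {suc k} κ ℝ = toℕ-injective (begin
  toℕ (Plane.next ℝ (combine κ 0F))            ≡⟨ toℕ-fromℕ< _ ⟩
  suc (toℕ (combine {suc k} {2} κ 0F)) % n     ≡⟨ cong (_% n) suc-combine ⟩
  toℕ (combine {suc k} {2} κ 1F) % n           ≡⟨ m<n⇒m%n≡m (toℕ<n (combine {suc k} {2} κ 1F)) ⟩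
  toℕ (combine {suc k} {2} κ 1F)               ∎)
  where
  open ≡-Reasoning
  n = suc k ℕ.* 2
  suc-combine : suc (toℕ (combine {suc k} {2} κ 0F)) ≡ toℕ (combine {suc k} {2} κ 1F)
  suc-combine = trans (cong suc (toℕ-combine κ 0F))
    (trans (sym (ℕₚ.+-suc (2 ℕ.* toℕ κ) 0)) (sym (toℕ-combine κ 1F)))

module _ (ℝ : RealField) {k : ℕ} (V : Fin (k ℕ.* 2) → Plane.Point ℝ) (convex : Plane.ConvexPosition ℝ V) where
  open Segments ℝ
  open OrderedField ℝ using (_<_; 0#)
  open Plane ℝ

  σ : Permutation′ (k ℕ.* 2)
  σ = proj₁ (proj₂ (proj₂ convex))

  vertex : Fin k × Fin 2 → Fin (k ℕ.* 2)
  vertex p = σ ⟨$⟩ʳ uncurry combine p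

  vertex-injective : ∀ {p q} → vertex p ≡ vertex q → p ≡ q
  vertex-injective {κ , b} {κ′ , b′} eq =
    uncurry (cong₂ _,_) (combine-injective κ b κ′ b′
      (trans (sym (inverseˡ σ)) (trans (cong (σ ⟨$⟩ˡ_) eq) (inverseˡ σ))))

  leftOfSide : ∀ κ {a} → a ∉ᵇ (vertex ∘ sideBlock κ) →
    0# < orient (V (vertex (κ , 0F))) (V (vertex (κ , 1F))) (V a)
  leftOfSide κ {a} a∉ = subst₂ (λ q r → 0# < orient (V (vertex (κ , 0F))) (V (σ ⟨$⟩ʳ q)) (V r))
      (next-combine κ ℝ) (inverseʳ σ)
      (proj₂ (proj₂ (proj₂ convex)) (combine κ 0F) (σ ⟨$⟩ˡ a)
        (λ e → a∉ (0F , trans (cong (σ ⟨$⟩ʳ_) (sym e)) (inverseʳ σ)))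
        (λ e → a∉ (1F , trans (cong (σ ⟨$⟩ʳ_) (sym (trans e (next-combine κ ℝ)))) (inverseʳ σ))))

  side-dodges : ∀ κ → Dodges ℝ V (vertex ∘ sideBlock κ)
  side-dodges κ _ a∉ b∉ = 0F , 1F , ((λ ()) ∘ cong proj₂ ∘ vertex-injective) ,
    sameSidePos⇒disjoint (leftOfSide κ a∉) (leftOfSide κ b∉)

  -- General position keeps the vertices of `T` off the line through `a` and `b`, and two of them
  -- lie on the same side of it.
  triangle-dodges : ∀ T → (∀ {i j} → i ≢ j → proj₁ (T i) ≢ proj₁ (T j)) → Dodges ℝ V (vertex ∘ T)
  triangle-dodges T noSide {a} {b} a≢b a∉ b∉
    with i , j , i≢j , dis ← edgeMissingLine (V a) (V b) (V ∘ vertex ∘ T)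
           (λ i → proj₁ (proj₂ convex) a b (vertex (T i)) a≢b
             (λ e → b∉ (i , sym e)) (λ e → a∉ (i , sym e))) =
    i , j , noSide i≢j ∘ cong proj₁ ∘ vertex-injective , swap-disjoint dis

  module _ {q : ℕ} (packing : Packing k q) where
    open Packing packing

    block : Fin k ⊎ Fin q → Fin 3 → Fin k × Fin 2
    block (inj₁ κ) = sideBlock κ
    block (inj₂ a) = triangle a

    block-dodges : ∀ x → Dodges ℝ V (vertex ∘ block x)
    block-dodges (inj₁ κ) = side-dodges κ
    block-dodges (inj₂ a) = triangle-dodges (triangle a) (noSide a)

    block-separated : ∀ x y → x ≢ y → Separated (block x) (block y)
    block-separated (inj₁ κ) (inj₁ κ′) x≢y = inj₁ (side-side (x≢y ∘ cong inj₁))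
    block-separated (inj₁ κ) (inj₂ a)  _   = inj₁ (side-triangle κ (noSide a))
    block-separated (inj₂ a) (inj₁ κ)  _   = inj₂ (side-triangle κ (noSide a))
    block-separated (inj₂ a) (inj₂ b)  x≢y = separated (x≢y ∘ cong inj₂)

    packing⇒achromatic : ∀ {a} → 2 ℕ.≤ k ℕ.+ q → IsAchromaticNumber (D ℝ V) a → k ℕ.+ q ℕ.≤ a
    packing⇒achromatic = blocks≤achromatic ℝ V (λ i → vertex ∘ block (Fin.splitAt k i))
      (λ i → block-dodges (Fin.splitAt k i))
      λ {i} {j} i≢j → Separated-map vertex (λ _ → ⊤) (λ _ _ → vertex-injective) _ _
        (block-separated (Fin.splitAt k i) (Fin.splitAt k j) λ e → i≢j (trans (sym (join-splitAt k q i)) (trans (cong (join k q) e) (join-splitAt k q j))))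

open import Data.Nat using (ℕ; _*_)
open import Data.Nat using (_+_; _∸_; _≤_; _<_; NonZero)
open import Data.Nat.Divisibility using (_∣_; divides)
open import Data.Integer as ℤ using (ℤ; +_; _⊖_)
open import Data.Integer.Properties as ℤₚ using ()

-- Packings built from three copies of a quasigroup

nxt : Fin 3 → Fin 3
nxt 0F = 1F
nxt 1F = 2F
nxt 2F = 0F

nxt≢ : ∀ i → nxt i ≢ i
nxt≢ 0F ()
nxt≢ 1F ()
nxt≢ 2F ()

nxt²≢ : ∀ i → nxt (nxt i) ≢ i
nxt²≢ 0F ()
nxt²≢ 1F ()
nxt²≢ 2F ()

-- `∞` is the common apex of the caps when n = 6t + 4; the other two cases exclude it through
-- `Valid`.
data Pt (Q : Set) : Set where
  at : Fin 3 → Q → Pt Q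
  ∞  : Pt Q

at-injective : ∀ {Q : Set} {i j} {x y : Q} → at i x ≡ at j y → i ≡ j × x ≡ y
at-injective refl = refl , refl

-- A repetition-free list of unordered pairs: `straight` and `crossed` cover the two ways in which
-- two entries can be the same set.
record Pairs (Q : Set) (q : ℕ) : Set where
  field
    fst snd  : Fin q → Q
    distinct : ∀ a → fst a ≢ snd a
    straight : ∀ {a b} → fst a ≡ fst b → snd a ≡ snd b → a ≡ b
    crossed  : ∀ {a b} → fst a ≡ snd b → snd a ≡ fst b → a ≡ b

[_,_,_] : ∀ {P : Set} → P → P → P → Fin 3 → P
[ p , q , r ] 0F = p
[ p , q , r ] 1F = q
[ p , q , r ] 2F = r

distinct₃ : ∀ {P : Set} (f : Fin 3 → P) → f 0F ≢ f 1F → f 0F ≢ f 2F → f 1F ≢ f 2F →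
  ∀ {i j} → i ≢ j → f i ≢ f j
distinct₃ f a b c {0F} {0F} i≢j = contradiction refl i≢j
distinct₃ f a b c {0F} {1F} _   = a
distinct₃ f a b c {0F} {2F} _   = b
distinct₃ f a b c {1F} {0F} _   = ≢-sym a
distinct₃ f a b c {1F} {1F} i≢j = contradiction refl i≢j
distinct₃ f a b c {1F} {2F} _   = c
distinct₃ f a b c {2F} {0F} _   = ≢-sym b
distinct₃ f a b c {2F} {1F} _   = ≢-sym c
distinct₃ f a b c {2F} {2F} i≢j = contradiction refl i≢j

module Levels {Q : Set} (_≟ᵠ_ : DecidableEquality Q) (op : Fin 3 → Q → Q → Q)
              (op-comm : ∀ i x y → op i x y ≡ op i y x)
              (op-cancel : ∀ i x {y z} → op i x y ≡ op i x z → y ≡ z) where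

  base : Fin 3 → Q → Q → Fin 3 → Pt Q
  base i x y = [ at i x , at i y , at (nxt i) (op i x y) ]

  at∈? : ∀ i x B → Dec (at i x ∈ᵇ B)
  at∈? i x B = any? λ k → B k ≟at
    where
    _≟at : ∀ p → Dec (p ≡ at i x)
    at j y ≟at = map′ (uncurry (cong₂ at)) at-injective (j ≟ i ×-dec y ≟ᵠ x)
    ∞      ≟at = no λ ()

  -- Only a common vertex `at i x` is treated. Exchanging `x` and `y` handles `at i y`, and if
  -- neither lies in `B`, the edge between them avoids `B`.
  MeetsOnce : (Fin 3 → Pt Q) → Fin 3 → Q → Q → Set
  MeetsOnce B i x y = at i x ∈ᵇ B → at i y ∉ᵇ B × at (nxt i) (op i x y) ∉ᵇ B

  -- Points of `B` on consecutive levels form a diagonal edge, from `x` to `op i x x`. No base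
  -- triangle contains one, since by cancellation `op i x y` equals `op i x x` only for `y` equal to
  -- `x`.
  diagonal-meetsOnce : ∀ {B} →
    (∀ {i x y} → at i x ∈ᵇ B → at i y ∈ᵇ B → x ≡ y) →
    (∀ {i x z} → at i x ∈ᵇ B → at (nxt i) z ∈ᵇ B → z ≡ op i x x) →
    ∀ i x y → x ≢ y → MeetsOnce B i x y
  diagonal-meetsOnce transversal diagonal i x y x≢y x∈ =
    (λ y∈ → x≢y (transversal x∈ y∈)) , λ z∈ → x≢y (sym (op-cancel i x (diagonal x∈ z∈)))

  diagonal-noSide : ∀ {K : Set} (side : Pt Q → K) →
    (∀ i x y → x ≢ y → side (at i x) ≢ side (at i y)) →
    (∀ i x z → z ≢ op i x x → side (at i x) ≢ side (at (nxt i) z)) →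
    ∀ i x y → x ≢ y → ∀ {j l} → j ≢ l → side (base i x y j) ≢ side (base i x y l)
  diagonal-noSide side level next i x y x≢y = distinct₃ (side ∘ base i x y)
    (level i x y x≢y)
    (next i x (op i x y) λ e → x≢y (sym (op-cancel i x e)))
    (next i y (op i x y) λ e → x≢y (op-cancel i y (trans (op-comm i y x) e)))

  vertical : Q → Fin 3 → Pt Q
  vertical f = [ at 0F f , at 1F f , at 2F f ]

  at∈vertical : ∀ {f i x} → at i x ∈ᵇ vertical f → x ≡ f
  at∈vertical (0F , refl) = refl
  at∈vertical (1F , refl) = refl
  at∈vertical (2F , refl) = refl

  vertical-meetsOnce : ∀ {f} → (∀ i → op i f f ≡ f) → ∀ i x y → x ≢ y → MeetsOnce (vertical f) i x y
  vertical-meetsOnce idem = diagonal-meetsOnce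
    (λ x∈ y∈ → trans (at∈vertical x∈) (sym (at∈vertical y∈)))
    λ {i} x∈ z∈ → trans (at∈vertical z∈) (trans (sym (idem i)) (sym (cong₂ (op i) (at∈vertical x∈) (at∈vertical x∈))))

  vertical-separated : ∀ {f g} → f ≢ g → Separated (vertical f) (vertical g)
  vertical-separated {f} {g} f≢g = inj₁ (avoiding 0F (λ ()) λ where
    0F _ p → f≢g (sym (at∈vertical p))
    1F _ p → f≢g (sym (at∈vertical p))
    2F _ p → f≢g (sym (at∈vertical p)))

  base-avoids : ∀ {B} i x y → x ≢ y → MeetsOnce B i x y → MeetsOnce B i y x → EdgeAvoids B (base i x y)
  base-avoids {B} i x y x≢y xy yx with at∈? i x B | at∈? i y B
  ... | yes x∈ | _      = avoiding 0F (nxt≢ i ∘ sym ∘ proj₁ ∘ at-injective) λ where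
    0F 0≢0 → contradiction refl 0≢0
    1F _   → proj₁ (xy x∈)
    2F _   → proj₂ (xy x∈)
  ... | no x∉  | yes y∈ = avoiding 1F (nxt≢ i ∘ sym ∘ proj₁ ∘ at-injective) λ where
    0F _   → x∉
    1F 1≢1 → contradiction refl 1≢1
    2F _   → subst (λ z → at (nxt i) z ∉ᵇ B) (op-comm i y x) (proj₂ (yx y∈))
  ... | no x∉  | no y∉  = avoiding 2F (x≢y ∘ proj₂ ∘ at-injective) λ where
    0F _   → x∉
    1F _   → y∉
    2F 2≢2 → contradiction refl 2≢2

  -- The levels `i`, `nxt i` and `nxt (nxt i)` are distinct, which excludes most coincidences. A
  -- common apex gives back the whole pair by cancellation, against `straight` or `crossed`.
  base-meetsOnce : ∀ i x y j x′ y′ → x ≢ y →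
    (i ≡ j → x ≡ x′ → y ≢ y′) → (i ≡ j → x ≡ y′ → y ≢ x′) → MeetsOnce (base j x′ y′) i x y
  base-meetsOnce i x y j x′ y′ x≢y straight crossed (0F , refl) =
    (λ { (0F , refl) → x≢y refl
       ; (1F , refl) → straight refl refl refl
       ; (2F , eq)   → nxt≢ i (proj₁ (at-injective eq)) }) ,
    (λ { (0F , eq) → nxt≢ i (sym (proj₁ (at-injective eq)))
       ; (1F , eq) → nxt≢ i (sym (proj₁ (at-injective eq)))
       ; (2F , eq) → straight refl refl (op-cancel i x (sym (proj₂ (at-injective eq)))) })
  base-meetsOnce i x y j x′ y′ x≢y straight crossed (1F , refl) =
    (λ { (0F , refl) → crossed refl refl refl
       ; (1F , refl) → x≢y refl
       ; (2F , eq)   → nxt≢ i (proj₁ (at-injective eq)) }) ,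
    (λ { (0F , eq) → nxt≢ i (sym (proj₁ (at-injective eq)))
       ; (1F , eq) → nxt≢ i (sym (proj₁ (at-injective eq)))
       ; (2F , eq) → crossed refl refl
           (op-cancel i x (trans (sym (proj₂ (at-injective eq))) (op-comm i x′ x))) })
  base-meetsOnce i x y j x′ y′ x≢y straight crossed (2F , refl) =
    (λ { (0F , eq) → nxt≢ j (sym (proj₁ (at-injective eq)))
       ; (1F , eq) → nxt≢ j (sym (proj₁ (at-injective eq)))
       ; (2F , eq) → x≢y (proj₂ (at-injective eq)) }) ,
    (λ { (0F , eq) → nxt²≢ j (sym (proj₁ (at-injective eq)))
       ; (1F , eq) → nxt²≢ j (sym (proj₁ (at-injective eq)))
       ; (2F , eq) → nxt≢ (nxt j) (sym (proj₁ (at-injective eq))) })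

  -- `K` is the natural index set of the sides, flattened by `code`; `pos` gives the side of a point
  -- and its end there. `Valid` delimits the points on which `pos` has to be injective.
  record LevelPacking (q : Fin 3 → ℕ) (e k : ℕ) : Set₁ where
    field
      pairs         : ∀ i → Pairs Q (q i)
      extra         : Fin e → Fin 3 → Pt Q
      extra-meets   : ∀ a i x y → x ≢ y → MeetsOnce (extra a) i x y
      extra-separated : ∀ {a b} → a ≢ b → Separated (extra a) (extra b)

      K             : Set
      code          : K → Fin k
      code-injective : ∀ {κ κ′} → code κ ≡ code κ′ → κ ≡ κ′
      pos           : Pt Q → K × Fin 2
      Valid         : Pt Q → Set
      pos-injective : ∀ {p q} → Valid p → Valid q → pos p ≡ pos q → p ≡ q

    open module P i = Pairs (pairs i) using (fst; snd)
    pairBase : (i : Fin 3) → Fin (q i) → Fin 3 → Pt Q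
    pairBase i a = base i (fst i a) (snd i a)

    field
      base-valid   : ∀ i a j → Valid (pairBase i a j)
      extra-valid  : ∀ a j → Valid (extra a j)
      base-noSide  : ∀ i a {j l} → j ≢ l → proj₁ (pos (pairBase i a j)) ≢ proj₁ (pos (pairBase i a l))
      extra-noSide : ∀ a {j l} → j ≢ l → proj₁ (pos (extra a j)) ≢ proj₁ (pos (extra a l))

  module _ {q e k} (L : LevelPacking q e k) where
    open LevelPacking L

    Index : Set
    Index = Σ (Fin 3) (Fin ∘ q) ⊎ Fin e

    decode : Fin (q 0F ℕ.+ (q 1F ℕ.+ (q 2F ℕ.+ e))) → Index
    decode a with splitAt (q 0F) a
    ... | inj₁ b = inj₁ (0F , b)
    ... | inj₂ b with splitAt (q 1F) b
    ...   | inj₁ c = inj₁ (1F , c)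
    ...   | inj₂ c with splitAt (q 2F) c
    ...     | inj₁ d = inj₁ (2F , d)
    ...     | inj₂ d = inj₂ d

    encode : Index → Fin (q 0F ℕ.+ (q 1F ℕ.+ (q 2F ℕ.+ e)))
    encode (inj₁ (0F , b)) = join (q 0F) _ (inj₁ b)
    encode (inj₁ (1F , b)) = join (q 0F) _ (inj₂ (join (q 1F) _ (inj₁ b)))
    encode (inj₁ (2F , b)) = join (q 0F) _ (inj₂ (join (q 1F) _ (inj₂ (join (q 2F) e (inj₁ b)))))
    encode (inj₂ b)        = join (q 0F) _ (inj₂ (join (q 1F) _ (inj₂ (join (q 2F) e (inj₂ b)))))

    encode-decode : ∀ a → encode (decode a) ≡ a
    encode-decode a with splitAt (q 0F) a | join-splitAt (q 0F) _ a
    ... | inj₁ b | eq = eq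
    ... | inj₂ b | eq with splitAt (q 1F) b | join-splitAt (q 1F) _ b
    ...   | inj₁ c | eq′ = trans (cong (λ z → join (q 0F) _ (inj₂ z)) eq′) eq
    ...   | inj₂ c | eq′ with splitAt (q 2F) c | join-splitAt (q 2F) e c
    ...     | inj₁ d | eq″ = trans (cong (λ z → join (q 0F) _ (inj₂ (join (q 1F) _ (inj₂ z)))) eq″)
                               (trans (cong (λ z → join (q 0F) _ (inj₂ z)) eq′) eq)
    ...     | inj₂ d | eq″ = trans (cong (λ z → join (q 0F) _ (inj₂ (join (q 1F) _ (inj₂ z)))) eq″)
                               (trans (cong (λ z → join (q 0F) _ (inj₂ z)) eq′) eq)

    triangleAt : Index → Fin 3 → Pt Q
    triangleAt (inj₁ (i , a)) = pairBase i a
    triangleAt (inj₂ a)       = extra a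

    triangleAt-valid : ∀ x j → Valid (triangleAt x j)
    triangleAt-valid (inj₁ (i , a)) = base-valid i a
    triangleAt-valid (inj₂ a)       = extra-valid a

    triangleAt-noSide : ∀ x {j l} → j ≢ l → proj₁ (pos (triangleAt x j)) ≢ proj₁ (pos (triangleAt x l))
    triangleAt-noSide (inj₁ (i , a)) = base-noSide i a
    triangleAt-noSide (inj₂ a)       = extra-noSide a

    pairBase-avoids : ∀ a i b → EdgeAvoids (extra a) (pairBase i b)
    pairBase-avoids a i b = base-avoids i _ _ (P.distinct i b)
      (extra-meets a i _ _ (P.distinct i b)) (extra-meets a i _ _ (≢-sym (P.distinct i b)))

    triangleAt-separated : ∀ x y → x ≢ y → Separated (triangleAt x) (triangleAt y)
    triangleAt-separated (inj₁ (i , a)) (inj₁ (j , b)) x≢y = inj₂ (base-avoids i _ _ (P.distinct i a)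
        (base-meetsOnce i _ _ j _ _ (P.distinct i a)
          (λ { refl f s → x≢y (cong (λ c → inj₁ (i , c)) (P.straight i f s)) })
          (λ { refl f s → x≢y (cong (λ c → inj₁ (i , c)) (P.crossed i f s)) }))
        (base-meetsOnce i _ _ j _ _ (≢-sym (P.distinct i a))
          (λ { refl f s → x≢y (cong (λ c → inj₁ (i , c)) (P.crossed i s f)) })
          (λ { refl f s → x≢y (cong (λ c → inj₁ (i , c)) (P.straight i s f)) })))
    triangleAt-separated (inj₁ (i , a)) (inj₂ b) x≢y = inj₂ (pairBase-avoids b i a)
    triangleAt-separated (inj₂ a) (inj₁ (i , b)) x≢y = inj₁ (pairBase-avoids a i b)
    triangleAt-separated (inj₂ a) (inj₂ b) x≢y = extra-separated (x≢y ∘ cong inj₂)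

    packing : Packing k (q 0F ℕ.+ (q 1F ℕ.+ (q 2F ℕ.+ e)))
    packing = record
      { triangle  = λ a → place ∘ triangleAt (decode a)
      ; noSide    = λ a j≢l → triangleAt-noSide (decode a) j≢l ∘ code-injective
      ; separated = λ {a} {b} a≢b → Separated-map place Valid
          (λ vp vq eq → pos-injective vp vq
            (cong₂ _,_ (code-injective (cong proj₁ eq)) (cong proj₂ eq)))
          (triangleAt-valid (decode a)) (triangleAt-valid (decode b))
          (triangleAt-separated (decode a) (decode b)
            λ eq → a≢b (trans (sym (encode-decode a)) (trans (cong encode eq) (encode-decode b))))
      }
      where
      place : Pt Q → Fin k × Fin 2
      place = map₁ code ∘ pos

-- Arithmetic modulo m

module Modular (m : ℕ) .{{_ : NonZero m}} where

  infix 4 _≈_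

  -- Multiples of `m` are allowed on both sides, so congruence needs no subtraction.
  record _≈_ (a b : ℕ) : Set where
    constructor congruent
    field
      p q : ℕ
      eq  : a + p * m ≡ b + q * m

  ≡⇒≈ : ∀ {a b} → a ≡ b → a ≈ b
  ≡⇒≈ a≡b = congruent 0 0 (cong (_+ 0) a≡b)

  ≈-sym : ∀ {a b} → a ≈ b → b ≈ a
  ≈-sym (congruent p q eq) = congruent q p (sym eq)

  +-cong : ∀ {a b c d} → a ≈ b → c ≈ d → a + c ≈ b + d
  +-cong {a} {b} {c} {d} (congruent p q eq) (congruent r s eq′) = congruent (p + r) (q + s) (begin
    a + c + (p + r) * m        ≡⟨ shuffle a c p r m ⟩
    (a + p * m) + (c + r * m)  ≡⟨ cong₂ _+_ eq eq′ ⟩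
    (b + q * m) + (d + s * m)  ≡⟨ shuffle b d q s m ⟨
    b + d + (q + s) * m        ∎)
    where
    open ≡-Reasoning
    shuffle : ∀ a c p r m → a + c + (p + r) * m ≡ (a + p * m) + (c + r * m)
    shuffle = solve-∀

  +-cancelˡ : ∀ c {a b} → c + a ≈ c + b → a ≈ b
  +-cancelˡ c {a} {b} (congruent p q eq) = congruent p q
    (ℕₚ.+-cancelˡ-≡ c _ _ (trans (sym (ℕₚ.+-assoc c a (p * m))) (trans eq (ℕₚ.+-assoc c b (q * m)))))

  -- Adding the two congruences puts `b` on both sides, where it cancels.
  ≈-trans : ∀ {a b c} → a ≈ b → b ≈ c → a ≈ c
  ≈-trans {a} {b} {c} ab bc = +-cancelˡ b (≈-trans′ (+-cong ab bc))
    where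
    ≈-trans′ : a + b ≈ b + c → b + a ≈ b + c
    ≈-trans′ = subst (_≈ b + c) (ℕₚ.+-comm a b)

  *-congˡ : ∀ k {a b} → a ≈ b → k * a ≈ k * b
  *-congˡ zero    a≈b = ≡⇒≈ refl
  *-congˡ (suc k) a≈b = +-cong a≈b (*-congˡ k a≈b)

  +-multiple : ∀ a k → a + k * m ≈ a
  +-multiple a k = congruent 0 k (ℕₚ.+-identityʳ _)

  ≈⇒≡ : ∀ {a b} → a < m → b < m → a ≈ b → a ≡ b
  ≈⇒≡ {a} {b} a<m b<m (congruent p q eq) = begin
    a               ≡⟨ m<n⇒m%n≡m a<m ⟨
    a % m           ≡⟨ [m+kn]%n≡m%n a p m ⟨
    (a + p * m) % m ≡⟨ cong (_% m) eq ⟩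
    (b + q * m) % m ≡⟨ [m+kn]%n≡m%n b q m ⟩
    b % m           ≡⟨ m<n⇒m%n≡m b<m ⟩
    b               ∎
    where open ≡-Reasoning

  residue : ℕ → Fin m
  residue a = fromℕ< (m%n<n a m)

  residue-≈ : ∀ a → toℕ (residue a) ≈ a
  residue-≈ a = ≈-trans (≡⇒≈ (toℕ-fromℕ< _)) (≈-sym (subst (_≈ a % m) (sym (m≡m%n+[m/n]*n a m)) (+-multiple _ (a / m))))

-- Enumeration of unordered pairs

triangular : ℕ → ℕ
triangular zero    = zero
triangular (suc m) = m + triangular m

-- `triangular m` is m(m - 1)/2, the number of 2-subsets of an m-set; this form avoids subtraction
-- and division.
twice-triangular : ∀ m → triangular m + triangular m + m ≡ m * m
twice-triangular zero    = refl
twice-triangular (suc m) = begin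
  (m + T) + (m + T) + suc m  ≡⟨ rearrange m T ⟩
  suc (m + m + (T + T + m))  ≡⟨ cong (λ z → suc (m + m + z)) (twice-triangular m) ⟩
  suc (m + m + m * m)        ≡⟨ square m ⟩
  suc m * suc m              ∎
  where
  open ≡-Reasoning
  T = triangular m
  rearrange : ∀ m T → (m + T) + (m + T) + suc m ≡ suc (m + m + (T + T + m))
  rearrange = solve-∀
  square : ∀ m → suc (m + m + m * m) ≡ suc m * suc m
  square = solve-∀

pairAt : ∀ m → Fin (triangular m) → Fin m × Fin m
pairAt (suc m) a with splitAt m a
... | inj₁ b = zero , suc b
... | inj₂ b = suc (proj₁ (pairAt m b)) , suc (proj₂ (pairAt m b))

pairAt-< : ∀ m a → proj₁ (pairAt m a) Fin.< proj₂ (pairAt m a)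
pairAt-< (suc m) a with splitAt m a
... | inj₁ b = s≤s z≤n
... | inj₂ b = s≤s (pairAt-< m b)

pairAt-injective : ∀ m {a b} → proj₁ (pairAt m a) ≡ proj₁ (pairAt m b) →
  proj₂ (pairAt m a) ≡ proj₂ (pairAt m b) → a ≡ b
pairAt-injective (suc m) {a} {b} e₁ e₂ = splitAt-injective m (pieces e₁ e₂)
  where
  pieces : proj₁ (pairAt (suc m) a) ≡ proj₁ (pairAt (suc m) b) →
    proj₂ (pairAt (suc m) a) ≡ proj₂ (pairAt (suc m) b) → splitAt m a ≡ splitAt m b
  pieces e₁ e₂ with splitAt m a | splitAt m b
  ... | inj₁ _ | inj₁ _ = cong inj₁ (suc-injective e₂)
  ... | inj₂ _ | inj₂ _ = cong inj₂ (pairAt-injective m (suc-injective e₁) (suc-injective e₂))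

allPairs : ∀ {Q : Set} {m} (f : Fin m → Q) → (∀ {x y} → f x ≡ f y → x ≡ y) → Pairs Q (triangular m)
allPairs {m = m} f f-injective = record
  { fst      = f ∘ proj₁ ∘ pairAt m
  ; snd      = f ∘ proj₂ ∘ pairAt m
  ; distinct = λ a e → Fₚ.<-irrefl (f-injective e) (pairAt-< m a)
  ; straight = λ e₁ e₂ → pairAt-injective m (f-injective e₁) (f-injective e₂)
  -- Every entry of `pairAt` is increasing, so no entry is the reversal of another.
  ; crossed  = λ {a} {b} e₁ e₂ → contradiction
      (subst₂ Fin._<_ (f-injective e₁) (f-injective e₂) (pairAt-< m a))
      (Fₚ.<-asym (pairAt-< m b))
  }

-- Signed residues and means modulo 2t + 1

data Signed (t : ℕ) : Set where
  o    : Signed t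
  +[_] : Fin t → Signed t
  -[_] : Fin t → Signed t

-- +[ u ] and -[ u ] stand for the residues ±(1 + u) modulo 2t + 1.
module SignedResidues (t : ℕ) where
  m : ℕ
  m = suc (t + t)

  open Modular m public

  -- The negatives are listed in reverse, so that `-[ u ]` has the value m - (1 + u).
  toFin : Signed t → Fin m
  toFin o      = zero
  toFin +[ u ] = suc (u ↑ˡ t)
  toFin -[ u ] = suc (t ↑ʳ opposite u)

  ofFin : Fin m → Signed t
  ofFin zero = o
  ofFin (suc v) with splitAt t v
  ... | inj₁ u = +[ u ]
  ... | inj₂ u = -[ opposite u ]

  ofFin-toFin : ∀ x → ofFin (toFin x) ≡ x
  ofFin-toFin o = refl
  ofFin-toFin +[ u ] rewrite splitAt-↑ˡ t u t = refl
  ofFin-toFin -[ u ] rewrite splitAt-↑ʳ t t (opposite u) = cong -[_] (opposite-involutive u)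

  toFin-ofFin : ∀ v → toFin (ofFin v) ≡ v
  toFin-ofFin zero = refl
  toFin-ofFin (suc v) with splitAt t v | join-splitAt t t v
  ... | inj₁ u | eq = cong suc eq
  ... | inj₂ u | eq = cong suc (trans (cong (t ↑ʳ_) (opposite-involutive u)) eq)

  toFin-injective : ∀ {x y} → toFin x ≡ toFin y → x ≡ y
  toFin-injective {x} {y} eq = trans (sym (ofFin-toFin x)) (trans (cong ofFin eq) (ofFin-toFin y))

  ofFin-injective : ∀ {v w} → ofFin v ≡ ofFin w → v ≡ w
  ofFin-injective {v} {w} eq = trans (sym (toFin-ofFin v)) (trans (cong toFin eq) (toFin-ofFin w))

  _≟ˢ_ : DecidableEquality (Signed t)
  x ≟ˢ y = map′ toFin-injective (cong toFin) (toFin x ≟ toFin y)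

  val : Signed t → ℕ
  val x = toℕ (toFin x)

  val-≈-injective : ∀ {x y} → val x ≈ val y → x ≡ y
  val-≈-injective {x} {y} v = toFin-injective (toℕ-injective (≈⇒≡ (toℕ<n (toFin x)) (toℕ<n (toFin y)) v))

  val-opposite : ∀ u → val +[ u ] + val -[ u ] ≡ m
  val-opposite u = begin
    suc (toℕ (u ↑ˡ t)) + suc (toℕ (t ↑ʳ opposite u))
      ≡⟨ cong₂ (λ a b → suc a + suc b) (toℕ-↑ˡ u t) (trans (toℕ-↑ʳ t (opposite u)) (cong (λ z → t + z) (opposite-prop u))) ⟩
    suc (toℕ u) + suc (t + (t ∸ suc (toℕ u)))
      ≡⟨ rearrange (suc (toℕ u)) t (t ∸ suc (toℕ u)) ⟩
    suc (t + (suc (toℕ u) + (t ∸ suc (toℕ u))))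
      ≡⟨ cong (λ z → suc (t + z)) (ℕₚ.m+[n∸m]≡n (toℕ<n u)) ⟩
    suc (t + t) ∎
    where
    open ≡-Reasoning
    rearrange : ∀ a b c → a + suc (b + c) ≡ suc (b + (a + c))
    rearrange = solve-∀

  m≈0 : m ≈ 0
  m≈0 = subst (_≈ 0) (ℕₚ.+-identityʳ m) (+-multiple 0 1)

  residueOf : ℕ → Signed t
  residueOf a = ofFin (residue a)

  residueOf-≈ : ∀ a → val (residueOf a) ≈ a
  residueOf-≈ a = ≈-trans (≡⇒≈ (cong toℕ (toFin-ofFin (residue a)))) (residue-≈ a)

  -- t + 1 is the inverse of 2.
  halved : ∀ a → suc t * (a + a) ≈ a
  halved a = ≈-trans (≡⇒≈ (expand t a)) (+-multiple a a)
    where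
    expand : ∀ t a → suc t * (a + a) ≡ a + a * suc (t + t)
    expand = solve-∀

  doubling-injective : ∀ {a b} → a + a ≈ b + b → a ≈ b
  doubling-injective {a} {b} e = ≈-trans (≈-sym (halved a)) (≈-trans (*-congˡ (suc t) e) (halved b))

  half : ℕ → Signed t
  half a = residueOf (suc t * a)

  half-double : ∀ a → val (half a) + val (half a) ≈ a
  half-double a = ≈-trans (+-cong (residueOf-≈ (suc t * a)) (residueOf-≈ (suc t * a))) (≈-trans (≡⇒≈ (factor t a)) (halved a))
    where
    factor : ∀ t a → suc t * a + suc t * a ≡ suc t * (a + a)
    factor = solve-∀

  -- The idempotent commutative quasigroup of the Bose construction, (x + y)/2 in a cyclic group of
  -- odd order.
  mean : Signed t → Signed t → Signed t
  mean x y = half (val x + val y)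

  mean-comm : ∀ x y → mean x y ≡ mean y x
  mean-comm x y = cong half (ℕₚ.+-comm (val x) (val y))

  mean-cancel : ∀ x {y z} → mean x y ≡ mean x z → y ≡ z
  mean-cancel x {y} {z} eq = val-≈-injective (+-cancelˡ (val x)
    (≈-trans (≈-sym (half-double _)) (subst (λ w → val w + val w ≈ val x + val z) (sym eq) (half-double _))))

  mean-idem : ∀ x → mean x x ≡ x
  mean-idem x = val-≈-injective (doubling-injective (half-double (val x + val x)))

-- The case n = 6t

prv : Fin 3 → Fin 3
prv i = nxt (nxt i)

nxt³ : ∀ i → nxt (prv i) ≡ i
nxt³ 0F = refl
nxt³ 1F = refl
nxt³ 2F = refl

module HalfIdempotent (t′ : ℕ) where
  t m : ℕ
  t = suc t′
  m = t * 2

  open Modular m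

  -- (u , b) is the residue u + t b; halving sends the residue 2u + b to it.
  Q : Set
  Q = Fin t × Fin 2

  val : Q → ℕ
  val (u , b) = toℕ (combine b u)

  val< : ∀ x → val x < m
  val< (u , b) = subst (val (u , b) <_) (ℕₚ.*-comm 2 t) (toℕ<n (combine b u))

  val-injective : ∀ {x y} → val x ≡ val y → x ≡ y
  val-injective {u , b} {v , c} eq with combine-injective b u c v (toℕ-injective eq)
  ... | refl , refl = refl

  half : Fin m → Q
  half = remQuot 2

  double : Q → ℕ
  double (u , b) = toℕ (combine u b)

  double-half : ∀ s → double (half s) ≡ toℕ s
  double-half s = cong toℕ (combine-remQuot {t} 2 s)

  -- Skolem's half-idempotent commutative quasigroup: `half` is a bijection, so cancellation
  -- survives although 2 is not invertible modulo 2t.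
  op : Fin 3 → Q → Q → Q
  op _ x y = half (residue (val x + val y))

  double-op : ∀ i x y → double (op i x y) ≈ val x + val y
  double-op i x y = ≈-trans (≡⇒≈ (double-half _)) (residue-≈ _)

  op-comm : ∀ i x y → op i x y ≡ op i y x
  op-comm i x y = cong (half ∘ residue) (ℕₚ.+-comm (val x) (val y))

  op-cancel : ∀ i x {y z} → op i x y ≡ op i x z → y ≡ z
  op-cancel i x {y} {z} eq = val-injective (≈⇒≡ (val< y) (val< z) (+-cancelˡ (val x)
    (≈-trans (≈-sym (double-op i x y)) (subst (λ w → double w ≈ val x + val z) (sym eq) (double-op i x z)))))

  double< : ∀ x → double x < m
  double< (u , b) = toℕ<n (combine u b)

  double-injective : ∀ {x y} → double x ≡ double y → x ≡ y
  double-injective {u , b} {v , c} eq with combine-injective u b v c (toℕ-injective eq)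
  ... | refl , refl = refl

  -- Doubling u + t b gives 2u + b m, which no longer depends on `b` modulo `m`.
  op-diagonal : ∀ i u b → op i (u , b) (u , b) ≡ (u , 0F)
  op-diagonal i u b = double-injective (≈⇒≡ (double< (op i (u , b) (u , b))) (double< (u , 0F))
    (≈-trans (double-op i (u , b) (u , b))
      (≈-trans (≡⇒≈ (trans (cong₂ _+_ (toℕ-combine b u) (toℕ-combine b u)) (trans (twice t (toℕ b) (toℕ u)) (cong (_+ toℕ b * m) (sym (toℕ-combine u 0F))))))
        (+-multiple (double (u , 0F)) (toℕ b)))))
    where
    twice : ∀ t b u → (t * b + u) + (t * b + u) ≡ 2 * u + 0 + b * (t * 2)
    twice = solve-∀

  fromFin : Fin (2 * t) → Q
  fromFin = swap ∘ remQuot {2} t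

  fromFin-injective : ∀ {s s′} → fromFin s ≡ fromFin s′ → s ≡ s′
  fromFin-injective eq = remQuot-injective 2 t (cong swap eq)

  open Levels (≡-dec _≟_ _≟_) op op-comm op-cancel

  -- The side `(u , j)` is the diagonal edge from `(u , 1F)` on level `j` to `(u , 0F)` on the next
  -- level. The diagonal edges starting at `(u , 0F)` form the triangle `vertical (u , 0F)`.
  pos : Pt Q → (Fin t × Fin 3) × Fin 2
  pos (at i (u , 0F)) = (u , prv i) , 1F
  pos (at i (u , 1F)) = (u , i) , 0F
  pos ∞               = (0F , 0F) , 0F

  Valid : Pt Q → Set
  Valid (at _ _) = ⊤
  Valid ∞        = ⊥

  unpos : (Fin t × Fin 3) × Fin 2 → Pt Q
  unpos ((u , j) , 0F) = at j (u , 1F)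
  unpos ((u , j) , 1F) = at (nxt j) (u , 0F)

  unpos-pos : ∀ {p} → Valid p → unpos (pos p) ≡ p
  unpos-pos {at i (u , 0F)} _ = cong (λ j → at j (u , 0F)) (nxt³ i)
  unpos-pos {at i (u , 1F)} _ = refl

  side : Pt Q → Fin t × Fin 3
  side = proj₁ ∘ pos

  side-level : ∀ i x y → x ≢ y → side (at i x) ≢ side (at i y)
  side-level i (u , 0F) (.u , 0F) x≢y refl = x≢y refl
  side-level i (u , 0F) (v , 1F)  _   eq   = nxt²≢ i (cong proj₂ eq)
  side-level i (u , 1F) (v , 0F)  _   eq   = nxt²≢ i (sym (cong proj₂ eq))
  side-level i (u , 1F) (.u , 1F) x≢y refl = x≢y refl

  side-next : ∀ i x z → z ≢ op i x x → side (at i x) ≢ side (at (nxt i) z)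
  side-next i (u , 0F) (v , 0F) _ eq = nxt²≢ i (trans (cong proj₂ eq) (nxt³ i))
  side-next i (u , 0F) (v , 1F) _ eq = nxt≢ (nxt i) (cong proj₂ eq)
  side-next i (u , 1F) (v , 0F) z≢ eq = z≢ (trans (cong (_, 0F) (sym (cong proj₁ eq))) (sym (op-diagonal i u 1F)))
  side-next i (u , 1F) (v , 1F) _ eq = nxt≢ i (sym (cong proj₂ eq))

  levelPacking : LevelPacking (λ _ → triangular (2 * t)) t (t * 3)
  levelPacking = record
    { pairs           = λ _ → allPairs fromFin fromFin-injective
    ; extra           = λ u → vertical (u , 0F)
    ; extra-meets     = λ u → vertical-meetsOnce λ i → op-diagonal i u 0F
    ; extra-separated = λ u≢v → vertical-separated (u≢v ∘ cong proj₁)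
    ; code            = uncurry combine
    ; code-injective  = λ { {u , i} {v , j} eq → uncurry (cong₂ _,_) (combine-injective u i v j eq) }
    ; pos             = pos
    ; Valid           = Valid
    ; pos-injective   = λ vp vq eq → trans (sym (unpos-pos vp)) (trans (cong unpos eq) (unpos-pos vq))
    ; base-valid      = λ { i a 0F → tt ; i a 1F → tt ; i a 2F → tt }
    ; extra-valid     = λ { u 0F → tt ; u 1F → tt ; u 2F → tt }
    ; base-noSide     = λ i a → diagonal-noSide side side-level side-next i _ _
                          (Pairs.distinct (allPairs fromFin fromFin-injective) a)
    ; extra-noSide    = λ u → distinct₃ (side ∘ vertical (u , 0F)) (λ ()) (λ ()) (λ ())
    }

-- The case n = 6t + 4

module Twisted (t : ℕ) where
  open SignedResidues t

  neg : Signed t → Signed t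
  neg o      = o
  neg +[ u ] = -[ u ]
  neg -[ u ] = +[ u ]

  neg² : ∀ x → neg (neg x) ≡ x
  neg² o      = refl
  neg² +[ _ ] = refl
  neg² -[ _ ] = refl

  -- Untwisted, the diagonal edges of each residue would close into a triangle. The sign change from
  -- level 2 to level 0 joins those of `+[ u ]` and `-[ u ]` into a hexagon, whose edges can
  -- alternate.
  twist : Fin 3 → Signed t → Signed t
  twist 0F x = x
  twist 1F x = x
  twist 2F x = neg x

  twist² : ∀ i x → twist i (twist i x) ≡ x
  twist² 0F x = refl
  twist² 1F x = refl
  twist² 2F x = neg² x

  op : Fin 3 → Signed t → Signed t → Signed t
  op i x y = twist i (mean x y)

  op-comm : ∀ i x y → op i x y ≡ op i y x
  op-comm i x y = cong (twist i) (mean-comm x y)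

  op-cancel : ∀ i x {y z} → op i x y ≡ op i x z → y ≡ z
  op-cancel i x eq = mean-cancel x
    (trans (sym (twist² i _)) (trans (cong (twist i) eq) (twist² i _)))

  op-diagonal : ∀ i x → op i x x ≡ twist i x
  op-diagonal i x = cong (twist i) (mean-idem x)

  open Levels _≟ˢ_ op op-comm op-cancel

  Side : Set
  Side = Fin t × Fin 3 ⊎ Fin 2

  -- For each u, the diagonal edges form a hexagon +₀ +₁ +₂ -₀ -₁ -₂, whose edges are
  -- alternately sides and bases of triangles with apex ∞.
  pos : Pt (Signed t) → Side × Fin 2
  pos (at 0F o)      = inj₂ 0F , 0F
  pos (at 1F o)      = inj₂ 0F , 1F
  pos (at 2F o)      = inj₂ 1F , 0F
  pos ∞              = inj₂ 1F , 1F
  pos (at 0F +[ u ]) = inj₁ (u , 0F) , 0F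
  pos (at 1F +[ u ]) = inj₁ (u , 0F) , 1F
  pos (at 2F +[ u ]) = inj₁ (u , 1F) , 0F
  pos (at 0F -[ u ]) = inj₁ (u , 1F) , 1F
  pos (at 1F -[ u ]) = inj₁ (u , 2F) , 0F
  pos (at 2F -[ u ]) = inj₁ (u , 2F) , 1F

  unpos : Side × Fin 2 → Pt (Signed t)
  unpos (inj₂ 0F       , 0F) = at 0F o
  unpos (inj₂ 0F       , 1F) = at 1F o
  unpos (inj₂ 1F       , 0F) = at 2F o
  unpos (inj₂ 1F       , 1F) = ∞
  unpos (inj₁ (u , 0F) , 0F) = at 0F +[ u ]
  unpos (inj₁ (u , 0F) , 1F) = at 1F +[ u ]
  unpos (inj₁ (u , 1F) , 0F) = at 2F +[ u ]
  unpos (inj₁ (u , 1F) , 1F) = at 0F -[ u ]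
  unpos (inj₁ (u , 2F) , 0F) = at 1F -[ u ]
  unpos (inj₁ (u , 2F) , 1F) = at 2F -[ u ]

  unpos-pos : ∀ p → unpos (pos p) ≡ p
  unpos-pos (at 0F o)      = refl
  unpos-pos (at 1F o)      = refl
  unpos-pos (at 2F o)      = refl
  unpos-pos ∞              = refl
  unpos-pos (at 0F +[ _ ]) = refl
  unpos-pos (at 1F +[ _ ]) = refl
  unpos-pos (at 2F +[ _ ]) = refl
  unpos-pos (at 0F -[ _ ]) = refl
  unpos-pos (at 1F -[ _ ]) = refl
  unpos-pos (at 2F -[ _ ]) = refl

  side : Pt (Signed t) → Side
  side = proj₁ ∘ pos

  -- The residue of the side's point on level `i`; where the side has none, the value is chosen so
  -- that `onLevel-next` holds.
  onLevel : Fin 3 → Side → Signed t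
  onLevel i  (inj₂ _)        = o
  onLevel 0F (inj₁ (u , 1F)) = -[ u ]
  onLevel 0F (inj₁ (u , _))  = +[ u ]
  onLevel 1F (inj₁ (u , 0F)) = +[ u ]
  onLevel 1F (inj₁ (u , _))  = -[ u ]
  onLevel 2F (inj₁ (u , 2F)) = -[ u ]
  onLevel 2F (inj₁ (u , _))  = +[ u ]

  onLevel-side : ∀ i x → onLevel i (side (at i x)) ≡ x
  onLevel-side 0F o      = refl
  onLevel-side 1F o      = refl
  onLevel-side 2F o      = refl
  onLevel-side 0F +[ _ ] = refl
  onLevel-side 1F +[ _ ] = refl
  onLevel-side 2F +[ _ ] = refl
  onLevel-side 0F -[ _ ] = refl
  onLevel-side 1F -[ _ ] = refl
  onLevel-side 2F -[ _ ] = refl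

  onLevel-next : ∀ i x → onLevel (nxt i) (side (at i x)) ≡ twist i x
  onLevel-next 0F o      = refl
  onLevel-next 1F o      = refl
  onLevel-next 2F o      = refl
  onLevel-next 0F +[ _ ] = refl
  onLevel-next 1F +[ _ ] = refl
  onLevel-next 2F +[ _ ] = refl
  onLevel-next 0F -[ _ ] = refl
  onLevel-next 1F -[ _ ] = refl
  onLevel-next 2F -[ _ ] = refl

  side-level : ∀ i x y → x ≢ y → side (at i x) ≢ side (at i y)
  side-level i x y x≢y eq =
    x≢y (trans (sym (onLevel-side i x)) (trans (cong (onLevel i) eq) (onLevel-side i y)))

  side-next : ∀ i x z → z ≢ op i x x → side (at i x) ≢ side (at (nxt i) z)
  side-next i x z z≢ eq = z≢ (trans (sym (onLevel-side (nxt i) z))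
    (trans (cong (onLevel (nxt i)) (sym eq)) (trans (onLevel-next i x) (sym (op-diagonal i x)))))

  -- The first ends, in the direction of `nxt`, of the three hexagon edges that are not sides.
  root : Fin t × Fin 3 → Fin 3 × Signed t
  root (u , 0F) = 1F , +[ u ]
  root (u , 1F) = 0F , -[ u ]
  root (u , 2F) = 2F , -[ u ]

  cap : Fin 3 × Signed t → Fin 3 → Pt (Signed t)
  cap (i , x) = [ ∞ , at i x , at (nxt i) (twist i x) ]

  cap-meetsOnce : ∀ r i x y → x ≢ y → MeetsOnce (cap r) i x y
  cap-meetsOnce r = diagonal-meetsOnce (transversal r) (diagonal r)
    where
    transversal : ∀ r {i x y} → at i x ∈ᵇ cap r → at i y ∈ᵇ cap r → x ≡ y
    transversal r       (1F , refl) (1F , refl) = refl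
    transversal (i , x) (1F , refl) (2F , eq)   = contradiction (proj₁ (at-injective eq)) (nxt≢ i)
    transversal (i , x) (2F , refl) (1F , eq)   = contradiction (sym (proj₁ (at-injective eq))) (nxt≢ i)
    transversal r       (2F , refl) (2F , refl) = refl
    diagonal : ∀ r {i x z} → at i x ∈ᵇ cap r → at (nxt i) z ∈ᵇ cap r → z ≡ op i x x
    diagonal (i , x) (1F , refl) (1F , eq) = contradiction (sym (proj₁ (at-injective eq))) (nxt≢ i)
    diagonal (i , x) (1F , refl) (2F , eq) = trans (sym (proj₂ (at-injective eq))) (sym (op-diagonal i x))
    diagonal (i , x) (2F , refl) (1F , eq) = contradiction (sym (proj₁ (at-injective eq))) (nxt²≢ i)
    diagonal (i , x) (2F , refl) (2F , eq) = contradiction (sym (proj₁ (at-injective eq))) (nxt≢ (nxt i))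

  -- The bases of the caps match up the points of each hexagon, so such a point determines its cap.
  -- The second argument is a default for `∞` and the points over `o`.
  owner : Pt (Signed t) → Fin t × Fin 3 → Fin t × Fin 3
  owner ∞              d = d
  owner (at _ o)       d = d
  owner (at 0F +[ u ]) _ = u , 2F
  owner (at 1F +[ u ]) _ = u , 0F
  owner (at 2F +[ u ]) _ = u , 0F
  owner (at 0F -[ u ]) _ = u , 1F
  owner (at 1F -[ u ]) _ = u , 1F
  owner (at 2F -[ u ]) _ = u , 2F

  owner-cap : ∀ c k d → k ≢ 0F → owner (cap (root c) k) d ≡ c
  owner-cap c        0F d k≢0 = contradiction refl k≢0
  owner-cap (u , 0F) 1F d _ = refl
  owner-cap (u , 1F) 1F d _ = refl
  owner-cap (u , 2F) 1F d _ = refl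
  owner-cap (u , 0F) 2F d _ = refl
  owner-cap (u , 1F) 2F d _ = refl
  owner-cap (u , 2F) 2F d _ = refl

  cap-separated : ∀ c d → c ≢ d → Separated (cap (root c)) (cap (root d))
  cap-separated c d c≢d = inj₁ (avoiding 0F (nxt≢ (proj₁ (root d)) ∘ sym ∘ proj₁ ∘ at-injective) foreign)
    where
    foreign : ∀ k → k ≢ 0F → cap (root d) k ∉ᵇ cap (root c)
    foreign 0F k≢0 _         = k≢0 refl
    foreign 1F k≢0 (0F , ())
    foreign 2F k≢0 (0F , ())
    foreign k@(suc _) k≢0 (l@(suc _) , eq) = c≢d (begin
      c                          ≡⟨ owner-cap c l c (λ ()) ⟨
      owner (cap (root c) l) c   ≡⟨ cong (λ p → owner p c) eq ⟩
      owner (cap (root d) k) c   ≡⟨ owner-cap d k c (λ ()) ⟩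
      d ∎)
      where open ≡-Reasoning

  cap-noSide : ∀ c {j l} → j ≢ l → side (cap (root c) j) ≢ side (cap (root c) l)
  cap-noSide c@(u , 0F) = distinct₃ (side ∘ cap (root c)) (λ ()) (λ ()) (λ ())
  cap-noSide c@(u , 1F) = distinct₃ (side ∘ cap (root c)) (λ ()) (λ ()) (λ ())
  cap-noSide c@(u , 2F) = distinct₃ (side ∘ cap (root c)) (λ ()) (λ ()) (λ ())

  code : Side → Fin (t * 3 + 2)
  code (inj₁ (u , i)) = join (t * 3) 2 (inj₁ (combine u i))
  code (inj₂ b)       = join (t * 3) 2 (inj₂ b)

  code-injective : ∀ {κ κ′} → code κ ≡ code κ′ → κ ≡ κ′
  code-injective {inj₁ (u , i)} {inj₁ (v , j)} eq with join-injective (t * 3) 2 (inj₁ (combine u i)) (inj₁ (combine v j)) eq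
  ... | e = cong inj₁ (uncurry (cong₂ _,_) (combine-injective u i v j (inj₁-injective e)))
  code-injective {inj₁ (u , i)} {inj₂ c} eq with () ← join-injective (t * 3) 2 (inj₁ (combine u i)) (inj₂ c) eq
  code-injective {inj₂ b} {inj₁ (v , j)} eq with () ← join-injective (t * 3) 2 (inj₂ b) (inj₁ (combine v j)) eq
  code-injective {inj₂ b} {inj₂ c} eq = cong inj₂ (inj₂-injective (join-injective (t * 3) 2 (inj₂ b) (inj₂ c) eq))

  levelPacking : LevelPacking (λ _ → triangular m) (t * 3) (t * 3 + 2)
  levelPacking = record
    { pairs           = λ _ → allPairs ofFin ofFin-injective
    ; extra           = cap ∘ root ∘ remQuot 3
    ; extra-meets     = λ a → cap-meetsOnce (root (remQuot 3 a))
    ; extra-separated = λ {a} {b} a≢b → cap-separated (remQuot 3 a) (remQuot 3 b) (a≢b ∘ remQuot-injective t 3)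
    ; code            = code
    ; code-injective  = code-injective
    ; pos             = pos
    ; Valid           = λ _ → ⊤
    ; pos-injective   = λ {p} {q} _ _ eq → trans (sym (unpos-pos p)) (trans (cong unpos eq) (unpos-pos q))
    ; base-valid      = λ _ _ _ → tt
    ; extra-valid     = λ _ _ → tt
    ; base-noSide     = λ i a → diagonal-noSide side side-level side-next i _ _
                          (Pairs.distinct (allPairs ofFin ofFin-injective) a)
    ; extra-noSide    = λ a → cap-noSide (remQuot 3 a)
    }

-- The case n = 6t + 2

module Punctured (t : ℕ) where
  open SignedResidues t

  nonzero : Fin (t + t) → Signed t
  nonzero c = ofFin (suc c)

  nonzero-injective : ∀ {c d} → nonzero c ≡ nonzero d → c ≡ d
  nonzero-injective = suc-injective ∘ ofFin-injective

  nonzero≢o : ∀ c → nonzero c ≢ o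
  nonzero≢o c e with () ← ofFin-injective {suc c} {zero} e

  mean-unique : ∀ x y {z} → val z + val z ≈ val x + val y → mean x y ≡ z
  mean-unique x y e = val-≈-injective (doubling-injective (≈-trans (half-double (val x + val y)) (≈-sym e)))

  mean-opposite : ∀ u → mean +[ u ] -[ u ] ≡ o
  mean-opposite u = mean-unique +[ u ] -[ u ] (≈-sym (≈-trans (≡⇒≈ (val-opposite u)) m≈0))

  around : Signed t → Signed t → Signed t
  around x y = residueOf (val x + val y)

  around-cancel : ∀ x {y z} → around x y ≡ around x z → y ≡ z
  around-cancel x {y} {z} eq = val-≈-injective (+-cancelˡ (val x) (≈-trans (≈-sym (residueOf-≈ (val x + val y)))
    (subst (λ w → val w ≈ val x + val z) (sym eq) (residueOf-≈ (val x + val z)))))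

  mean-around : ∀ x d → mean (around x +[ d ]) (around x -[ d ]) ≡ x
  mean-around x d = mean-unique (around x +[ d ]) (around x -[ d ]) (≈-sym (≈-trans
    (+-cong (residueOf-≈ (val x + val +[ d ])) (residueOf-≈ (val x + val -[ d ])))
    (≈-trans (≡⇒≈ (trans (interchange (val x) (val +[ d ]) (val -[ d ])) (cong (λ z → val x + val x + z) (trans (val-opposite d) (sym (ℕₚ.*-identityˡ m))))))
      (+-multiple (val x + val x) 1))))
    where
    interchange : ∀ x a b → x + a + (x + b) ≡ x + x + (a + b)
    interchange = solve-∀

  -- A pair with mean c consists of c + d and c - d. Listing pairs by centre makes it possible to
  -- omit exactly those with mean `o`, whose apex on level 0 is the deleted point.
  center : Fin ((t + t) * t) → Signed t
  center a = nonzero (proj₁ (remQuot t a))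

  radius : Fin ((t + t) * t) → Fin t
  radius a = proj₂ (remQuot {t + t} t a)

  centered : (Fin t → Signed t) → Fin ((t + t) * t) → Signed t
  centered sign a = around (center a) (sign (radius a))

  mean-centered : ∀ a → mean (centered +[_] a) (centered -[_] a) ≡ center a
  mean-centered a = mean-around (center a) (radius a)

  centered-determines : ∀ {a b} → center a ≡ center b → radius a ≡ radius b → a ≡ b
  centered-determines c r = remQuot-injective (t + t) t (cong₂ _,_ (nonzero-injective c) r)

  centeredPairs : Pairs (Signed t) ((t + t) * t)
  centeredPairs = record
    { fst      = centered +[_]
    ; snd      = centered -[_]
    ; distinct = λ a e → +≢- (around-cancel (center a) e)
    ; straight = λ {a} {b} f s →
        -- The mean of the two entries recovers the centre, and cancellation then recovers the
        -- radius.
        let c = trans (sym (mean-centered a)) (trans (cong₂ mean f s) (mean-centered b)) in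
        centered-determines c (+-injective (around-cancel (center a)
          (trans f (cong (λ z → around z +[ radius b ]) (sym c)))))
    ; crossed  = λ {a} {b} f s →
        let c = trans (sym (mean-centered a)) (trans (cong₂ mean f s)
                  (trans (mean-comm (centered -[_] b) (centered +[_] b)) (mean-centered b))) in
        contradiction (around-cancel (center a) (trans f (cong (λ z → around z -[ radius b ]) (sym c)))) +≢-
    }
    where
    +≢- : ∀ {u v} → +[ u ] ≢ -[ v ]
    +≢- ()
    +-injective : ∀ {u v} → +[ u ] ≡ +[ v ] → u ≡ v
    +-injective refl = refl

  halve : Signed t → Signed t
  halve x = half (val x)

  twice : Signed t → Signed t
  twice x = residueOf (val x + val x)

  twice-halve : ∀ x → twice (halve x) ≡ x
  twice-halve x = val-≈-injective (≈-trans (residueOf-≈ (val (halve x) + val (halve x))) (half-double (val x)))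

  twice-o : twice o ≡ o
  twice-o = val-≈-injective (residueOf-≈ 0)

  halve-o : ∀ {x} → halve x ≡ o → x ≡ o
  halve-o {x} e = trans (sym (twice-halve x)) (trans (cong twice e) twice-o)

  halve-injective : ∀ {x y} → halve x ≡ halve y → x ≡ y
  halve-injective {x} {y} e = trans (sym (twice-halve x)) (trans (cong twice e) (twice-halve y))

  -- `halve x` is the mean of `x` and `o`, so equality would force `y` to be `o`.
  halve≢mean : ∀ {x y} → y ≢ o → halve x ≢ mean x y
  halve≢mean {x} {y} y≢o e = y≢o (sym (val-≈-injective (+-cancelˡ (val x)
    (≈-trans (≡⇒≈ (ℕₚ.+-identityʳ (val x)))
      (≈-trans (≈-sym (half-double (val x)))
        (subst (λ z → val z + val z ≈ val x + val y) (sym e) (half-double (val x + val y))))))))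

  halve-fixed : ∀ {x} → halve x ≡ x → x ≡ o
  halve-fixed {x} e = val-≈-injective (+-cancelˡ (val x)
    (≈-trans (subst (λ z → val z + val z ≈ val x) e (half-double (val x))) (≡⇒≈ (sym (ℕₚ.+-identityʳ (val x))))))

  op : Fin 3 → Signed t → Signed t → Signed t
  op _ = mean

  open Levels _≟ˢ_ op (λ _ → mean-comm) (λ _ → mean-cancel)

  Side : Set
  Side = Signed t ⊎ Fin t

  -- The point at 0F o is deleted; the sides are what is left of the triples through it:
  -- {at 0F y , at 1F (y/2)}, {at 1F o , at 2F o} and {at 2F (+u) , at 2F (-u)}.
  pos : Pt (Signed t) → Side × Fin 2
  pos (at 0F x)      = inj₁ (halve x) , 1F
  pos (at 1F x)      = inj₁ x , 0F
  pos (at 2F o)      = inj₁ o , 1F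
  pos (at 2F +[ u ]) = inj₂ u , 0F
  pos (at 2F -[ u ]) = inj₂ u , 1F
  pos ∞              = inj₁ o , 0F

  Valid : Pt (Signed t) → Set
  Valid (at 0F x)      = x ≢ o
  Valid (at (suc _) _) = ⊤
  Valid ∞              = ⊥

  unpos : Side × Fin 2 → Pt (Signed t)
  unpos (inj₁ x      , 0F) = at 1F x
  unpos (inj₁ o      , 1F) = at 2F o
  unpos (inj₁ +[ u ] , 1F) = at 0F (twice +[ u ])
  unpos (inj₁ -[ u ] , 1F) = at 0F (twice -[ u ])
  unpos (inj₂ u      , 0F) = at 2F +[ u ]
  unpos (inj₂ u      , 1F) = at 2F -[ u ]

  unpos-nonzero : ∀ {x} → x ≢ o → unpos (inj₁ x , 1F) ≡ at 0F (twice x)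
  unpos-nonzero {o}      o≢o = contradiction refl o≢o
  unpos-nonzero {+[ _ ]} _   = refl
  unpos-nonzero { -[ _ ]} _  = refl

  unpos-pos : ∀ {p} → Valid p → unpos (pos p) ≡ p
  unpos-pos {at 0F x} x≢o     = trans (unpos-nonzero (x≢o ∘ halve-o)) (cong (at 0F) (twice-halve x))
  unpos-pos {at 1F x} _       = refl
  unpos-pos {at 2F o} _       = refl
  unpos-pos {at 2F +[ u ]} _  = refl
  unpos-pos {at 2F -[ u ]} _  = refl

  side : Pt (Signed t) → Side
  side = proj₁ ∘ pos

  side₂-inj₁ : ∀ {x} z → inj₁ x ≡ side (at 2F z) → x ≡ o × z ≡ o
  side₂-inj₁ o refl = refl , refl

  side₂ : ∀ {x y} → x ≢ y → mean x y ≢ o → side (at 2F x) ≢ side (at 2F y)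
  side₂ {o}      {o}      x≢y _  _    = x≢y refl
  side₂ {+[ u ]} {+[ .u ]} x≢y _ refl = x≢y refl
  side₂ {+[ u ]} { -[ .u ]} _ ≢o refl = ≢o (mean-opposite u)
  side₂ { -[ u ]} {+[ .u ]} _ ≢o refl = ≢o (trans (mean-comm -[ u ] +[ u ]) (mean-opposite u))
  side₂ { -[ u ]} { -[ .u ]} x≢y _ refl = x≢y refl

  -- Triples through the deleted point are dropped: on level 0 the pairs containing `o`, on level 2
  -- the pairs with mean `o`.
  size : Fin 3 → ℕ
  size 0F = triangular (t + t)
  size 1F = triangular m
  size 2F = (t + t) * t

  pairs : ∀ i → Pairs (Signed t) (size i)
  pairs 0F = allPairs nonzero nonzero-injective
  pairs 1F = allPairs ofFin ofFin-injective
  pairs 2F = centeredPairs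

  triple : ∀ i → Fin (size i) → Fin 3 → Pt (Signed t)
  triple i a = base i (Pairs.fst (pairs i) a) (Pairs.snd (pairs i) a)

  triple-valid : ∀ i a j → Valid (triple i a j)
  triple-valid 0F a 0F = nonzero≢o _
  triple-valid 0F a 1F = nonzero≢o _
  triple-valid 0F a 2F = tt
  triple-valid 1F a 0F = tt
  triple-valid 1F a 1F = tt
  triple-valid 1F a 2F = tt
  triple-valid 2F a 0F = tt
  triple-valid 2F a 1F = tt
  triple-valid 2F a 2F = nonzero≢o _ ∘ trans (sym (mean-centered a))

  triple-noSide : ∀ i a {j l} → j ≢ l → side (triple i a j) ≢ side (triple i a l)
  triple-noSide 0F a = distinct₃ (side ∘ triple 0F a)
    (Pairs.distinct (pairs 0F) a ∘ halve-injective ∘ inj₁-injective)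
    (halve≢mean {x} {y} (nonzero≢o _) ∘ inj₁-injective)
    (λ e → halve≢mean {y} {x} (nonzero≢o _) (trans (inj₁-injective e) (mean-comm x y)))
    where
    x = Pairs.fst (pairs 0F) a
    y = Pairs.snd (pairs 0F) a
  triple-noSide 1F a = distinct₃ (side ∘ triple 1F a)
    (Pairs.distinct (pairs 1F) a ∘ inj₁-injective)
    (λ e → let x≡o , z≡o = side₂-inj₁ (mean x y) e in
      x≢y (sym (mean-cancel x (trans z≡o (sym (trans (mean-idem x) x≡o))))))
    (λ e → let y≡o , z≡o = side₂-inj₁ (mean x y) e in
      x≢y (mean-cancel y (trans (mean-comm y x) (trans z≡o (sym (trans (mean-idem y) y≡o))))))
    where
    x = Pairs.fst (pairs 1F) a
    y = Pairs.snd (pairs 1F) a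
    x≢y = Pairs.distinct (pairs 1F) a
  triple-noSide 2F a = distinct₃ (side ∘ triple 2F a)
    (side₂ (Pairs.distinct (pairs 2F) a) mean≢o)
    (λ e → mean≢o (halve-o (proj₁ (side₂-inj₁ (centered +[_] a) (sym e)))))
    (λ e → mean≢o (halve-o (proj₁ (side₂-inj₁ (centered -[_] a) (sym e)))))
    where
    mean≢o : mean (centered +[_] a) (centered -[_] a) ≢ o
    mean≢o = nonzero≢o _ ∘ trans (sym (mean-centered a))

  code : Side → Fin (m + t)
  code (inj₁ x) = join m t (inj₁ (toFin x))
  code (inj₂ u) = join m t (inj₂ u)

  code-injective : ∀ {κ κ′} → code κ ≡ code κ′ → κ ≡ κ′
  code-injective {inj₁ x} {inj₁ y} eq =
    cong inj₁ (toFin-injective (inj₁-injective (join-injective m t (inj₁ (toFin x)) (inj₁ (toFin y)) eq)))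
  code-injective {inj₁ x} {inj₂ v} eq with () ← join-injective m t (inj₁ (toFin x)) (inj₂ v) eq
  code-injective {inj₂ u} {inj₁ y} eq with () ← join-injective m t (inj₂ u) (inj₁ (toFin y)) eq
  code-injective {inj₂ u} {inj₂ v} eq = cong inj₂ (inj₂-injective (join-injective m t (inj₂ u) (inj₂ v) eq))

  levelPacking : LevelPacking size (t + t) (m + t)
  levelPacking = record
    { pairs           = pairs
    -- The vertical triple over `o` contains the deleted point and is left out.
    ; extra           = vertical ∘ nonzero
    ; extra-meets     = λ c → vertical-meetsOnce λ _ → mean-idem (nonzero c)
    ; extra-separated = λ c≢d → vertical-separated (c≢d ∘ nonzero-injective)
    ; code            = code
    ; code-injective  = code-injective
    ; pos             = pos
    ; Valid           = Valid
    ; pos-injective   = λ vp vq eq → trans (sym (unpos-pos vp)) (trans (cong unpos eq) (unpos-pos vq))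
    ; base-valid      = triple-valid
    ; extra-valid     = λ { c 0F → nonzero≢o c ; c 1F → tt ; c 2F → tt }
    ; base-noSide     = triple-noSide
    ; extra-noSide    = λ c → distinct₃ (side ∘ vertical (nonzero c))
        (nonzero≢o c ∘ halve-fixed ∘ inj₁-injective)
        (nonzero≢o c ∘ proj₂ ∘ side₂-inj₁ (nonzero c))
        (nonzero≢o c ∘ proj₂ ∘ side₂-inj₁ (nonzero c))
    }

-- Counting

-- With this choice n²/6 + h(n) ≤ a says n² + n ≤ 6a + 8. The integer difference `⊖` makes the
-- values below 8 negative instead of truncating them.
h : ℕ → ℚ
h n = (n ⊖ 8) ℚ./ 6

toℚᵘ-/ : ∀ i d → ℚ.toℚᵘ (i ℚ./ suc d) ℚᵘ.≃ mkℚᵘ i d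
toℚᵘ-/ i d = ℚₚ.toℚᵘ-fromℚᵘ (mkℚᵘ i d)

/-mono : ∀ i j c d → i ℤ.* + suc d ℤ.≤ j ℤ.* + suc c → i ℚ./ suc c ℚ.≤ j ℚ./ suc d
/-mono i j c d i≤j = ℚₚ.toℚᵘ-cancel-≤ (begin
  ℚ.toℚᵘ (i ℚ./ suc c)  ≃⟨ toℚᵘ-/ i c ⟩
  mkℚᵘ i c              ≤⟨ *≤* i≤j ⟩
  mkℚᵘ j d              ≃⟨ toℚᵘ-/ j d ⟨
  ℚ.toℚᵘ (j ℚ./ suc d)  ∎)
  where open ℚᵘₚ.≤-Reasoning

/6-+ : ∀ i j → (i ℚ./ 6) ℚ.+ (j ℚ./ 6) ≡ (i ℤ.+ j) ℚ./ 6
/6-+ i j = ℚₚ.toℚᵘ-injective (begin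
  ℚ.toℚᵘ ((i ℚ./ 6) ℚ.+ (j ℚ./ 6))            ≈⟨ ℚₚ.toℚᵘ-homo-+ (i ℚ./ 6) (j ℚ./ 6) ⟩
  ℚ.toℚᵘ (i ℚ./ 6) ℚᵘ.+ ℚ.toℚᵘ (j ℚ./ 6)      ≈⟨ ℚᵘₚ.+-cong (toℚᵘ-/ i 5) (toℚᵘ-/ j 5) ⟩
  mkℚᵘ i 5 ℚᵘ.+ mkℚᵘ j 5                      ≈⟨ *≡* (trans (cong (ℤ._* + 6) (sym (ℤₚ.*-distribʳ-+ (+ 6) i j))) (ℤₚ.*-assoc (i ℤ.+ j) (+ 6) (+ 6))) ⟩
  mkℚᵘ (i ℤ.+ j) 5                            ≈⟨ toℚᵘ-/ (i ℤ.+ j) 5 ⟨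
  ℚ.toℚᵘ ((i ℤ.+ j) ℚ./ 6)                    ∎)
  where open import Relation.Binary.Reasoning.Setoid ℚᵘₚ.≃-setoid

/-* : ∀ i j d → (i ℚ./ suc d) ℚ.* (j ℚ./ 1) ≡ (i ℤ.* j) ℚ./ suc d
/-* i j d = ℚₚ.toℚᵘ-injective (begin
  ℚ.toℚᵘ ((i ℚ./ suc d) ℚ.* (j ℚ./ 1))            ≈⟨ ℚₚ.toℚᵘ-homo-* (i ℚ./ suc d) (j ℚ./ 1) ⟩
  ℚ.toℚᵘ (i ℚ./ suc d) ℚᵘ.* ℚ.toℚᵘ (j ℚ./ 1)      ≈⟨ ℚᵘₚ.*-cong (toℚᵘ-/ i d) (toℚᵘ-/ j 0) ⟩
  mkℚᵘ i d ℚᵘ.* mkℚᵘ j 0                          ≈⟨ *≡* (cong (λ z → (i ℤ.* j) ℤ.* (+ z)) (sym (ℕₚ.*-identityʳ (suc d)))) ⟩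
  mkℚᵘ (i ℤ.* j) d                                ≈⟨ toℚᵘ-/ (i ℤ.* j) d ⟨
  ℚ.toℚᵘ ((i ℤ.* j) ℚ./ suc d)                    ∎)
  where open import Relation.Binary.Reasoning.Setoid ℚᵘₚ.≃-setoid

bound-from-ℕ : ∀ n a → n ℕ.* n ℕ.+ n ℕ.≤ a ℕ.* 6 ℕ.+ 8 → ((+ (n ℕ.* n)) ℚ./ 6) ℚ.+ h n ℚ.≤ (+ a) ℚ./ 1
bound-from-ℕ n a n²+n≤ = subst (ℚ._≤ (+ a) ℚ./ 1) (sym (/6-+ (+ (n ℕ.* n)) (n ⊖ 8)))
  (/-mono (+ (n ℕ.* n) ℤ.+ (n ⊖ 8)) (+ a) 5 0 (begin
    (+ (n ℕ.* n) ℤ.+ (n ⊖ 8)) ℤ.* + 1  ≡⟨ ℤₚ.*-identityʳ _ ⟩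
    + (n ℕ.* n) ℤ.+ (n ⊖ 8)            ≡⟨ ℤₚ.distribʳ-⊖-+-pos (n ℕ.* n) n 8 ⟩
    (n ℕ.* n ℕ.+ n) ⊖ 8                ≤⟨ ℤₚ.⊖-monoˡ-≤ 8 n²+n≤ ⟩
    (a ℕ.* 6 ℕ.+ 8) ⊖ 8                ≡⟨ ℤₚ.distribʳ-⊖-+-pos (a ℕ.* 6) 8 8 ⟨
    + (a ℕ.* 6) ℤ.+ + 0                ≡⟨ ℤₚ.+-identityʳ (+ (a ℕ.* 6)) ⟩
    + (a ℕ.* 6)                        ≡⟨ ℤₚ.pos-* a 6 ⟩
    + a ℤ.* + 6                        ∎))
  where open ℤₚ.≤-Reasoning

/-mono-ℕ : ∀ p q c d → p ℕ.* suc d ℕ.≤ q ℕ.* suc c → (+ p) ℚ./ suc c ℚ.≤ (+ q) ℚ./ suc d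
/-mono-ℕ p q c d p≤q = /-mono (+ p) (+ q) c d (subst₂ ℤ._≤_ (ℤₚ.pos-* p (suc d)) (ℤₚ.pos-* q (suc c)) (ℤ.+≤+ p≤q))

lower : ∀ m → 8 ℕ.≤ m → (m ℕ.+ 8) ℕ.* 6 ℕ.≤ m ℕ.* 12
lower m 8≤m = ℕₚ.≤-trans (ℕₚ.*-monoˡ-≤ 6 (ℕₚ.+-monoʳ-≤ m 8≤m)) (ℕₚ.≤-reflexive (double m))
  where
  double : ∀ m → (m ℕ.+ m) ℕ.* 6 ≡ m ℕ.* 12
  double = solve-∀

upper : ∀ m → m ℕ.* 1 ℕ.≤ (m ℕ.+ 8) ℕ.* 6
upper m = ℕₚ.*-mono-≤ (ℕₚ.m≤m+n m 8) (s≤s z≤n)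

scaled : ∀ n d → ((+ 1) ℚ./ suc d) ℚ.* ((+ n) ℚ./ 1) ≡ (+ n) ℚ./ suc d
scaled n d = trans (/-* (+ 1) (+ n) d) (cong (ℚ._/ suc d) (ℤₚ.*-identityˡ (+ n)))

h-bounds : ∀ m → 8 ℕ.≤ m → ℚ.0ℚ ℚ.< (+ m) ℚ./ 6 ×
  ((+ 1) ℚ./ 12) ℚ.* ((+ (m ℕ.+ 8)) ℚ./ 1) ℚ.≤ (+ m) ℚ./ 6 ×
  (+ m) ℚ./ 6 ℚ.≤ ((+ 1) ℚ./ 1) ℚ.* ((+ (m ℕ.+ 8)) ℚ./ 1)
h-bounds m 8≤m =
  ℚₚ.positive⁻¹ ((+ m) ℚ./ 6) {{ℚₚ.normalize-pos m 6 {{_}} {{ℕ.>-nonZero (ℕₚ.≤-trans (s≤s z≤n) 8≤m)}}}} ,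
  subst (ℚ._≤ (+ m) ℚ./ 6) (sym (scaled (m ℕ.+ 8) 11)) (/-mono-ℕ (m ℕ.+ 8) m 11 5 (lower m 8≤m)) ,
  subst ((+ m) ℚ./ 6 ℚ.≤_) (sym (scaled (m ℕ.+ 8) 0)) (/-mono-ℕ m (m ℕ.+ 8) 5 0 (upper m))

-- (n - 8)/6 is at least n/12 exactly from n = 16 on, and it never exceeds n.
h-Θ : ThetaN h
h-Θ = (+ 1) ℚ./ 12 , (+ 1) ℚ./ 1 , 16 , ℚ.*<* (ℤ.+<+ (s≤s z≤n)) , ℚ.*<* (ℤ.+<+ (s≤s z≤n)) , bounds
  where
  bounds : ∀ n → 16 ℕ.≤ n → ℚ.0ℚ ℚ.< h n ×
    ((+ 1) ℚ./ 12) ℚ.* ((+ n) ℚ./ 1) ℚ.≤ h n × h n ℚ.≤ ((+ 1) ℚ./ 1) ℚ.* ((+ n) ℚ./ 1)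
  bounds n 16≤n = subst₂ (λ q n → ℚ.0ℚ ℚ.< q × ((+ 1) ℚ./ 12) ℚ.* ((+ n) ℚ./ 1) ℚ.≤ q × q ℚ.≤ ((+ 1) ℚ./ 1) ℚ.* ((+ n) ℚ./ 1))
    (cong (ℚ._/ 6) (sym (ℤₚ.⊖-≥ 8≤n))) (ℕₚ.m∸n+n≡m 8≤n)
    (h-bounds (n ℕ.∸ 8) (ℕₚ.∸-monoˡ-≤ 8 16≤n))
    where
    8≤n : 8 ℕ.≤ n
    8≤n = ℕₚ.≤-trans (ℕₚ.m≤m+n 8 8) 16≤n

-- Sizes of the packings and the final bound

DensePacking : ℕ → Set
DensePacking k = ∃[ q ] (Packing k q × (k * 2) * (k * 2) + k * 2 ≤ (k + q) * 6 + 8)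

emptyPacking : DensePacking 0
emptyPacking = 0 , record { triangle = λ () ; noSide = λ () ; separated = λ { {()} } } , z≤n

densePacking₀ : ∀ t → DensePacking (t * 3)
-- `HalfIdempotent` needs a nonzero modulus, so `t` equal to zero is treated apart.
densePacking₀ zero = emptyPacking
densePacking₀ (suc t′) = _ , Levels.packing _ op op-comm op-cancel levelPacking ,
    -- The 18t added to both sides is 9 times 2t, the linear term `twice-triangular` requires for
    -- 18T = 9(T + T). The other two cases add 12t + 3 and 18t + 9 for the same reason.
    ℕₚ.≤-trans (ℕₚ.≤-reflexive (ℕₚ.+-cancelʳ-≡ (18 * t) _ ((t * 3 + (T + (T + (T + t)))) * 6) (begin
      (t * 3 * 2) * (t * 3 * 2) + t * 3 * 2 + 18 * t  ≡⟨ before t ⟩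
      9 * ((2 * t) * (2 * t)) + 24 * t                ≡⟨ cong (λ z → 9 * z + 24 * t) (twice-triangular (2 * t)) ⟨
      9 * (T + T + 2 * t) + 24 * t                    ≡⟨ after t T ⟩
      (t * 3 + (T + (T + (T + t)))) * 6 + 18 * t      ∎)))
    (ℕₚ.m≤m+n _ 8)
  where
  open HalfIdempotent t′
  open ≡-Reasoning
  T = triangular (2 * t)
  before : ∀ t → (t * 3 * 2) * (t * 3 * 2) + t * 3 * 2 + 18 * t ≡ 9 * ((2 * t) * (2 * t)) + 24 * t
  before = solve-∀
  after : ∀ t T → 9 * (T + T + 2 * t) + 24 * t ≡ (t * 3 + (T + (T + (T + t)))) * 6 + 18 * t
  after = solve-∀

densePacking₁ : ∀ t → DensePacking (suc (t + t) + t)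
densePacking₁ t = _ , Levels.packing _ op _ _ levelPacking ,
    ℕₚ.≤-trans (ℕₚ.≤-reflexive (ℕₚ.+-cancelʳ-≡ (12 * t + 3) _ ((m + t + (S + (T + ((t + t) * t + (t + t))))) * 6) (begin
      ((m + t) * 2) * ((m + t) * 2) + (m + t) * 2 + (12 * t + 3)
        ≡⟨ before t ⟩
      3 * ((t + t) * (t + t)) + 3 * (m * m) + (12 * (t * t) + 30 * t + 6)
        ≡⟨ cong₂ (λ y z → 3 * y + 3 * z + (12 * (t * t) + 30 * t + 6)) (twice-triangular (t + t)) (twice-triangular m) ⟨
      3 * (S + S + (t + t)) + 3 * (T + T + m) + (12 * (t * t) + 30 * t + 6)
        ≡⟨ after t S T ⟩
      (m + t + (S + (T + ((t + t) * t + (t + t))))) * 6 + (12 * t + 3) ∎)))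
    (ℕₚ.m≤m+n _ 8)
  where
  open Punctured t
  open SignedResidues t using (m)
  open ≡-Reasoning
  S = triangular (t + t)
  T = triangular m
  before : ∀ t → ((suc (t + t) + t) * 2) * ((suc (t + t) + t) * 2) + (suc (t + t) + t) * 2 + (12 * t + 3) ≡
    3 * ((t + t) * (t + t)) + 3 * (suc (t + t) * suc (t + t)) + (12 * (t * t) + 30 * t + 6)
  before = solve-∀
  after : ∀ t S T → 3 * (S + S + (t + t)) + 3 * (T + T + suc (t + t)) + (12 * (t * t) + 30 * t + 6) ≡
    (suc (t + t) + t + (S + (T + ((t + t) * t + (t + t))))) * 6 + (12 * t + 3)
  after = solve-∀

-- The count is exact with the summand 8 included, so this case fixes that constant; in the other
-- two, n² + n equals 6(k + q).
densePacking₂ : ∀ t → DensePacking (t * 3 + 2)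
densePacking₂ t = _ , Levels.packing _ op op-comm op-cancel levelPacking ,
    ℕₚ.≤-reflexive (ℕₚ.+-cancelʳ-≡ (18 * t + 9) _ ((t * 3 + 2 + (T + (T + (T + t * 3)))) * 6 + 8) (begin
      ((t * 3 + 2) * 2) * ((t * 3 + 2) * 2) + (t * 3 + 2) * 2 + (18 * t + 9)
        ≡⟨ before t ⟩
      9 * (m * m) + (36 * t + 20)
        ≡⟨ cong (λ z → 9 * z + (36 * t + 20)) (twice-triangular m) ⟨
      9 * (T + T + m) + (36 * t + 20)
        ≡⟨ after t T ⟩
      (t * 3 + 2 + (T + (T + (T + t * 3)))) * 6 + 8 + (18 * t + 9) ∎))
  where
  open Twisted t
  open SignedResidues t using (m)
  open ≡-Reasoning
  T = triangular m
  before : ∀ t → ((t * 3 + 2) * 2) * ((t * 3 + 2) * 2) + (t * 3 + 2) * 2 + (18 * t + 9) ≡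
    9 * (suc (t + t) * suc (t + t)) + (36 * t + 20)
  before = solve-∀
  after : ∀ t T → 9 * (T + T + suc (t + t)) + (36 * t + 20) ≡
    (t * 3 + 2 + (T + (T + (T + t * 3)))) * 6 + 8 + (18 * t + 9)
  after = solve-∀

densePacking : ∀ k → DensePacking k
densePacking k with k divMod 3
... | result t 0F refl = densePacking₀ t
... | result t 1F refl = subst DensePacking (rearrange t) (densePacking₁ t)
  where
  rearrange : ∀ t → suc (t + t) + t ≡ 1 + t * 3
  rearrange = solve-∀
... | result t 2F refl = subst DensePacking (ℕₚ.+-comm (t * 3) 2) (densePacking₂ t)

achromatic-bound : ∀ ℝ k (V : Fin (k * 2) → Plane.Point ℝ) → Plane.ConvexPosition ℝ V →
  ∀ a → IsAchromaticNumber (D ℝ V) a → (k * 2) * (k * 2) + k * 2 ≤ a * 6 + 8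
-- Completing a colouring takes at least two blocks. For `k` at most 1 the left side is at most 6
-- and is absorbed by the 8.
achromatic-bound ℝ 0 V convex a _ = z≤n
achromatic-bound ℝ 1 V convex a _ = ℕₚ.≤-trans (ℕₚ.m≤m+n 6 2) (ℕₚ.m≤n+m 8 (a * 6))
achromatic-bound ℝ k@(suc (suc _)) V convex a isα with q , packing , dense ← densePacking k =
  ℕₚ.≤-trans dense (ℕₚ.+-monoˡ-≤ 8 (ℕₚ.*-monoˡ-≤ 6
    (packing⇒achromatic ℝ V convex packing (s≤s (s≤s z≤n)) isα)))

theorem7p5 : Σ (ℕ → ℚ) (λ h → ThetaN h ×
    (∀ (ℝ : RealField) (n : ℕ) → 2 ∣ n →
    (V : Fin n → Plane.Point ℝ) → Plane.ConvexPosition ℝ V →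
    ∀ (a : ℕ) → IsAchromaticNumber (D ℝ V) a →
    ((+ (n * n)) ℚ./ 6) ℚ.+ h n ℚ.≤ (+ a) ℚ./ 1))
theorem7p5 = h , h-Θ , λ { ℝ _ (divides k refl) V convex a isα →
  bound-from-ℕ (k * 2) a (achromatic-bound ℝ k V convex a isα) }
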